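{- Let $L\in(2,\infty]$ and let $S,S'\subseteq \mathbb{S}_L$ be dense integer-distance free subsets. Suppose $G=(S,E)$ and $G'=(S',E')$ are g.e.c. graphs on $S$ and $S'$ respectively. Then $G\equiv_{\mathcal{L}_G}G'$, i.e. $G$ and $G'$ are elementarily equivalent in the language $\mathcal{L}_G=\{E\}$ of graphs. Moreover, let $\mathcal{L}_{G,C}$ be the graph language expanded by ternary relation symbols $\{C_{z,t,k}: z,t,k\in\mathbb{Z}\}$, where in a graph with vertex set contained in $\mathbb{S}_L$ the relation $C_{z,t,k}(a,b,c)$ is interpreted as $C(a+_L[z],\,b+_L[t],\,c+_L[k])$. Then $G\equiv_{\mathcal{L}_{G,C}}G'$, and the common complete $\mathcal{L}_{G,C}$-theory (of all g.e.c. graphs on dense integer-distance free subsets of $\mathbb{S}_L$) has quantifier elimination.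
   Context: For real $L\ge 2$, the circle of length $L$ is the quotient group $\mathbb{S}_L=(\mathbb{R}/L\mathbb{Z},+_L)$; for $x\in\mathbb{R}$ write $[x]=x+L\mathbb{Z}$. It carries the metric $d_L(a,b)=\min\{|x-y|,L-|x-y|\}$, where $x,y\in[0,L)$ are the unique elements with $[x]=a,[y]=b$. The circular order $C(a,b,c)$ on $\mathbb{S}_L$ holds iff $x<y<z$ or $y<z<x$ or $z<x<y$, where $x,y,z\in[0,L)$ are such that $[x]=a,[y]=b,[z]=c$. For $L=\infty$, $\mathbb{S}_\infty$ denotes the additive group $\mathbb{R}$ with $[x]=x$, the usual metric $|x-y|$, and $C(a,b,c)$ iff $a<b<c$ or $b<c<a$ or $c<a<b$. A subset $S\subseteq\mathbb{S}_L$ is integer-distance free if there are no $u\neq v$ in $S$ and $n\in\mathbb{Z}$ with $d_L(u,v)=n \pmod L$ (for $L=\infty$: no two distinct points at integer distance). Let $(X,d)$ be a separable metric space without isolated points and $S\subseteq X$ dense. A (simple, undirected) graph $G$ with vertex set $S$ is geometrically existentially closed (g.e.c.) if (i) it has unit threshold: any two adjacent $u,v\in S$ satisfy $d(u,v)<1$; and (ii) for any vertex $s\in S$, any disjoint finite sets $A,B\subseteq S$ contained in the open unit ball $B_1(s)$, and any $\epsilon>0$, there is a vertex $v\in S\setminus(A\cup B)$ with $d(s,v)<\epsilon$ such that $v$ is adjacent to every vertex in $A$ and to no vertex in $B$. -}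

module Defs where

open import Level using (0ℓ; suc)
open import Algebra.Bundles using (AbelianGroup; CommutativeRing)
open import Algebra.Core using (Op₁; Op₂)
open import Algebra.Structures using (IsCommutativeRing)
import Algebra.Construct.NaturalChoice.Max as Max
import Algebra.Construct.NaturalChoice.Min as Min
import Algebra.Properties.CommutativeSemigroup as CommutativeSemigroupProperties
import Algebra.Properties.Monoid.Mult as Mult
import Algebra.Properties.Ring as RingProperties
open import Axiom.ExcludedMiddle using (ExcludedMiddle)
open import Data.Empty using (⊥; ⊥-elim)
open import Data.Fin.Base using (Fin)
open import Data.Integer.Base as ℤ using (ℤ; +_; -[1+_]; _⊖_)
import Data.Integer.Properties as ℤₚ
open import Data.List.Base using (List)
import Data.List.Membership.Setoid as Membership
import Data.List.Relation.Binary.Disjoint.Setoid as Disjointness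
open import Data.List.Relation.Unary.All using (All)
open import Data.Nat.Base as ℕ using (ℕ)
open import Data.Product.Base using (∃; Σ; _×_; _,_; proj₁; proj₂)
open import Data.Sum.Base using (_⊎_; inj₁; inj₂)
open import Data.Unit.Base using (⊤; tt)
open import Data.Vec.Base using (Vec; []; _∷_; lookup; map)
open import Data.Vec.Relation.Binary.Pointwise.Inductive using (Pointwise; []; _∷_)
open import Function.Bundles using (_⇔_)
open import Relation.Binary.Bundles using (Setoid; StrictTotalOrder; TotalOrder)
import Relation.Binary.Construct.On as On
open import Relation.Binary.Core using (Rel)
open import Relation.Binary.Definitions
  using (Symmetric; Irreflexive; _Respects_; _Respects₂_; tri<; tri≈; tri>)
import Relation.Binary.Properties.StrictTotalOrder as StrictTotalOrderProperties
import Relation.Binary.Reasoning.Setoid as SetoidReasoning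
open import Relation.Binary.Structures using (IsEquivalence; IsStrictTotalOrder)
open import Relation.Nullary.Decidable.Core using (yes; no)
open import Relation.Nullary.Negation.Core using (¬_)
open import Relation.Unary using (Pred)

------------------------------------------------------------------------
-- First-order logic with equality over relational languages

record Language : Set₁ where
  field
    Symbol : Set
    arity  : Symbol → ℕ

-- Domains are setoids; the equality symbol is interpreted by the setoid
-- equality, which every relation has to respect.
record Structure (ℒ : Language) : Set₁ where
  open Language ℒ
  field
    domain : Setoid 0ℓ 0ℓ
  open Setoid domain public
  field
    ⟦_⟧      : (r : Symbol) → Pred (Vec Carrier (arity r)) 0ℓ
    ⟦⟧-resp  : ∀ r {xs ys} → Pointwise _≈_ xs ys → ⟦ r ⟧ xs → ⟦ r ⟧ ys

-- Formula ℒ n has its free variables among n de Bruijn indices.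
data Formula (ℒ : Language) (n : ℕ) : Set where
  ⊥̇           : Formula ℒ n
  _≐_         : (i j : Fin n) → Formula ℒ n
  rel         : (r : Language.Symbol ℒ) → Vec (Fin n) (Language.arity ℒ r) → Formula ℒ n
  _⇒̇_ _∧̇_ _∨̇_ : (φ ψ : Formula ℒ n) → Formula ℒ n
  ∀̇_ ∃̇_       : (φ : Formula ℒ (ℕ.suc n)) → Formula ℒ n

Sentence : Language → Set
Sentence ℒ = Formula ℒ 0

¬̇_ : ∀ {ℒ n} → Formula ℒ n → Formula ℒ n
¬̇ φ = φ ⇒̇ ⊥̇

_⇔̇_ : ∀ {ℒ n} (φ ψ : Formula ℒ n) → Formula ℒ n
φ ⇔̇ ψ = (φ ⇒̇ ψ) ∧̇ (ψ ⇒̇ φ)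

data QuantifierFree {ℒ : Language} {n : ℕ} : Formula ℒ n → Set where
  ⊥̇   : QuantifierFree ⊥̇
  _≐_ : ∀ i j → QuantifierFree (i ≐ j)
  rel : ∀ r is → QuantifierFree (rel r is)
  _⇒̇_ : ∀ {φ ψ} → QuantifierFree φ → QuantifierFree ψ → QuantifierFree (φ ⇒̇ ψ)
  _∧̇_ : ∀ {φ ψ} → QuantifierFree φ → QuantifierFree ψ → QuantifierFree (φ ∧̇ ψ)
  _∨̇_ : ∀ {φ ψ} → QuantifierFree φ → QuantifierFree ψ → QuantifierFree (φ ∨̇ ψ)

module _ {ℒ : Language} where

  _⊨_[_] : (M : Structure ℒ) {n : ℕ} → Formula ℒ n → Vec (Structure.Carrier M) n → Set
  M ⊨ ⊥̇        [ ρ ] = ⊥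
  M ⊨ (i ≐ j)  [ ρ ] = Structure._≈_ M (lookup ρ i) (lookup ρ j)
  M ⊨ rel r is [ ρ ] = Structure.⟦_⟧ M r (map (lookup ρ) is)
  M ⊨ (φ ⇒̇ ψ)  [ ρ ] = M ⊨ φ [ ρ ] → M ⊨ ψ [ ρ ]
  M ⊨ (φ ∧̇ ψ)  [ ρ ] = M ⊨ φ [ ρ ] × M ⊨ ψ [ ρ ]
  M ⊨ (φ ∨̇ ψ)  [ ρ ] = M ⊨ φ [ ρ ] ⊎ M ⊨ ψ [ ρ ]
  M ⊨ (∀̇ φ)    [ ρ ] = ∀ x → M ⊨ φ [ x ∷ ρ ]
  M ⊨ (∃̇ φ)    [ ρ ] = ∃ λ x → M ⊨ φ [ x ∷ ρ ]

  ElementarilyEquivalent : Rel (Structure ℒ) 0ℓ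
  ElementarilyEquivalent M N = (σ : Sentence ℒ) → M ⊨ σ [ [] ] ⇔ N ⊨ σ [ [] ]

Theory : Language → Set₂
Theory ℒ = Pred (Sentence ℒ) (suc 0ℓ)

module _ {ℒ : Language} (T : Theory ℒ) where

  IsModel : Structure ℒ → Set₁
  IsModel M = ∀ σ → T σ → M ⊨ σ [ [] ]

  -- Consequence for formulas with free variables, i.e. for their universal
  -- closures.
  Entails : ∀ {n} → Formula ℒ n → Set₁
  Entails φ = ∀ M → IsModel M → ∀ ρ → M ⊨ φ [ ρ ]

  IsComplete : Set₁
  IsComplete = ∃ IsModel × ((σ : Sentence ℒ) → Entails σ ⊎ Entails (¬̇ σ))

  HasQuantifierElimination : Set₁
  HasQuantifierElimination =
    ∀ {n} (φ : Formula ℒ n) → ∃ λ ψ → QuantifierFree ψ × Entails (φ ⇔̇ ψ)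

------------------------------------------------------------------------
-- Graphs

-- Graphs are simple and undirected.
record Graph (V : Setoid 0ℓ 0ℓ) : Set₁ where
  open Setoid V
  field
    Adj        : Rel Carrier 0ℓ
    Adj-resp   : Adj Respects₂ _≈_
    Adj-sym    : Symmetric Adj
    Adj-irrefl : Irreflexive _≈_ Adj

record Subset (X : Setoid 0ℓ 0ℓ) : Set₁ where
  open Setoid X
  field
    Member      : Pred Carrier 0ℓ
    Member-resp : Member Respects _≈_

-- The points of a subset, with the equality of the ambient setoid.
points : ∀ {X} → Subset X → Setoid 0ℓ 0ℓ
points {X} S = On.setoid X (proj₁ {B = Subset.Member S})

Point : ∀ {X} → Subset X → Set
Point S = Setoid.Carrier (points S)

data SymG : Set where
  E : SymG

ℒG : Language
ℒG = record { Symbol = SymG ; arity = λ { E → 2 } }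

data SymGC : Set where
  E : SymGC
  C : (z t k : ℤ) → SymGC

ℒGC : Language
ℒGC = record { Symbol = SymGC ; arity = λ { E → 2 ; (C _ _ _) → 3 } }

structureG : ∀ {V} → Graph V → Structure ℒG
structureG {V} G = record
  { domain  = V
  ; ⟦_⟧     = λ { E (u ∷ v ∷ []) → Adj u v }
  ; ⟦⟧-resp = λ { E (p ∷ q ∷ []) uv → proj₁ Adj-resp q (proj₂ Adj-resp p uv) }
  }
  where open Graph G

------------------------------------------------------------------------
-- The real numbers: a Dedekind-complete ordered field, which is unique up
-- to unique isomorphism

record RealField : Set₁ where
  infix  4 _≈_ _<_
  infixl 6 _+_
  infixl 7 _*_
  field
    Carrier            : Set
    _≈_ _<_            : Rel Carrier 0ℓ
    _+_ _*_            : Op₂ Carrier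
    -_                 : Op₁ Carrier
    0# 1#              : Carrier
    isCommutativeRing  : IsCommutativeRing _≈_ _+_ _*_ -_ 0# 1#
    isStrictTotalOrder : IsStrictTotalOrder _≈_ _<_
    0<1                : 0# < 1#
    inverse            : ∀ x → ¬ x ≈ 0# → ∃ λ y → x * y ≈ 1#
    +-monoʳ-<          : ∀ z {x y} → x < y → z + x < z + y
    *-pos              : ∀ {x y} → 0# < x → 0# < y → 0# < x * y

  commutativeRing : CommutativeRing 0ℓ 0ℓ
  commutativeRing = record { isCommutativeRing = isCommutativeRing }

  open CommutativeRing commutativeRing public
    using (_-_; setoid; ring; +-cong; +-congˡ; +-congʳ; +-assoc; +-comm;
           +-identityˡ; +-identityʳ; -‿inverseˡ; -‿inverseʳ; -‿cong;
           +-monoid; +-commutativeSemigroup; refl; sym; trans)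

  strictTotalOrder : StrictTotalOrder 0ℓ 0ℓ 0ℓ
  strictTotalOrder = record { isStrictTotalOrder = isStrictTotalOrder }

  open StrictTotalOrder strictTotalOrder public
    using (compare; <-resp-≈) renaming (trans to <-trans; irrefl to <-irrefl)

  open StrictTotalOrderProperties strictTotalOrder public
    using (_≤_) renaming (totalOrder to ≤-totalOrder)

  open Min ≤-totalOrder public using (_⊓_)
  open Max ≤-totalOrder public using (_⊔_)

  IsUpperBound : Pred Carrier 0ℓ → Pred Carrier 0ℓ
  IsUpperBound P u = ∀ x → P x → x ≤ u

  field
    complete : ∀ (P : Pred Carrier 0ℓ) → ∃ P → ∃ (IsUpperBound P) →
               ∃ λ s → IsUpperBound P s × (∀ u → IsUpperBound P u → s ≤ u)

  ∣_∣ : Op₁ Carrier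
  ∣ x ∣ = x ⊔ (- x)

  open Mult +-monoid public using ()
    renaming (_×_ to _×ₙ_; ×-homo-+ to ×ₙ-homo-+)

  infixr 8 _·_

  _·_ : ℤ → Carrier → Carrier
  (+ n)    · x = n ×ₙ x
  -[1+ n ] · x = - (ℕ.suc n ×ₙ x)

  fromℤ : ℤ → Carrier
  fromℤ n = n · 1#

------------------------------------------------------------------------
-- Geometrically existentially closed graphs

-- d is meant to be the metric of a separable metric space X without isolated
-- points, and S a dense subset of X; neither is needed to state the conditions.
module _ (ℝ : RealField) {X : Setoid 0ℓ 0ℓ} where

  open RealField ℝ using (_<_; 0#; 1#) renaming (Carrier to R)

  module _ (d : Setoid.Carrier X → Setoid.Carrier X → R) (S : Subset X) where

    IsDense : Set
    IsDense = ∀ x ε → 0# < ε → ∃ λ (s : Point S) → d x (proj₁ s) < ε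

    open Membership (points S) using (_∉_)
    open Disjointness (points S) using (Disjoint)

    -- Finite sets of vertices are given by lists.
    record IsGEC (G : Graph (points S)) : Set where
      open Graph G
      field
        unitThreshold : ∀ (u v : Point S) → Adj u v → d (proj₁ u) (proj₁ v) < 1#
        extension     : ∀ (s : Point S) (A B : List (Point S)) → Disjoint A B →
                        All (λ a → d (proj₁ s) (proj₁ a) < 1#) A →
                        All (λ b → d (proj₁ s) (proj₁ b) < 1#) B →
                        ∀ ε → 0# < ε →
                        ∃ λ (v : Point S) → v ∉ A × v ∉ B × d (proj₁ s) (proj₁ v) < ε ×
                                All (λ a → Adj v a) A × All (λ b → ¬ Adj v b) B

------------------------------------------------------------------------
-- Consequences of the axioms for the reals

-- Excluded middle enters through the Archimedean property.
module RealProperties (em : ExcludedMiddle 0ℓ) (ℝ : RealField) where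

  open RealField ℝ renaming (Carrier to R)
  open RingProperties ring using (-0#≈0#; -‿involutive; -‿+-comm)
  open CommutativeSemigroupProperties +-commutativeSemigroup using (interchange)
  open SetoidReasoning setoid

  <-respˡ : ∀ {x y z} → x ≈ y → x < z → y < z
  <-respˡ = proj₂ <-resp-≈

  <-respʳ : ∀ {x y z} → x ≈ y → z < x → z < y
  <-respʳ = proj₁ <-resp-≈

  ≤-<-trans : ∀ {x y z} → x ≤ y → y < z → x < z
  ≤-<-trans (inj₁ x<y) y<z = <-trans x<y y<z
  ≤-<-trans (inj₂ x≈y) y<z = <-respˡ (sym x≈y) y<z

  <-≤-trans : ∀ {x y z} → x < y → y ≤ z → x < z
  <-≤-trans x<y (inj₁ y<z) = <-trans x<y y<z
  <-≤-trans x<y (inj₂ y≈z) = <-respʳ y≈z x<y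

  ≤⇒≯ : ∀ {x y} → x ≤ y → ¬ y < x
  ≤⇒≯ x≤y y<x = <-irrefl refl (≤-<-trans x≤y y<x)

  ≮⇒≥ : ∀ {x y} → ¬ x < y → y ≤ x
  ≮⇒≥ {x} {y} x≮y with compare x y
  ... | tri< x<y _ _ = ⊥-elim (x≮y x<y)
  ... | tri≈ _ x≈y _ = inj₂ (sym x≈y)
  ... | tri> _ _ y<x = inj₁ y<x

  +-monoˡ-< : ∀ z {x y} → x < y → x + z < y + z
  +-monoˡ-< z x<y = <-respˡ (+-comm z _) (<-respʳ (+-comm z _) (+-monoʳ-< z x<y))

  +-monoˡ-≤ : ∀ z {x y} → x ≤ y → x + z ≤ y + z
  +-monoˡ-≤ z (inj₁ x<y) = inj₁ (+-monoˡ-< z x<y)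
  +-monoˡ-≤ z (inj₂ x≈y) = inj₂ (+-congʳ x≈y)

  x+y-y≈x : ∀ x y → x + y - y ≈ x
  x+y-y≈x x y = begin
    x + y - y    ≈⟨ +-assoc x y (- y) ⟩
    x + (y - y)  ≈⟨ +-congˡ (-‿inverseʳ y) ⟩
    x + 0#       ≈⟨ +-identityʳ x ⟩
    x            ∎

  x-y+y≈x : ∀ x y → x - y + y ≈ x
  x-y+y≈x x y = begin
    x - y + y      ≈⟨ +-assoc x (- y) y ⟩
    x + (- y + y)  ≈⟨ +-congˡ (-‿inverseˡ y) ⟩
    x + 0#         ≈⟨ +-identityʳ x ⟩
    x              ∎

  x+y≤z⇒x≤z-y : ∀ {x y z} → x + y ≤ z → x ≤ z - y
  x+y≤z⇒x≤z-y {x} {y} {z} p with +-monoˡ-≤ (- y) p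
  ... | inj₁ q = inj₁ (<-respˡ (x+y-y≈x x y) q)
  ... | inj₂ q = inj₂ (trans (sym (x+y-y≈x x y)) q)

  x<y+z⇒x-z<y : ∀ {x y z} → x < y + z → x - z < y
  x<y+z⇒x-z<y {x} {y} {z} p = <-respʳ (x+y-y≈x y z) (+-monoˡ-< (- z) p)

  x<x+y : ∀ x {y} → 0# < y → x < x + y
  x<x+y x 0<y = <-respˡ (+-identityʳ x) (+-monoʳ-< x 0<y)

  0≤×ₙ : ∀ {a} → 0# < a → ∀ n → 0# ≤ n ×ₙ a
  0≤×ₙ 0<a ℕ.zero = inj₂ refl
  0≤×ₙ {a} 0<a (ℕ.suc n) =
    inj₁ (≤-<-trans (0≤×ₙ 0<a n) (<-respʳ (+-comm (n ×ₙ a) a) (x<x+y (n ×ₙ a) 0<a)))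

  archimedean : ∀ {a} → 0# < a → ∀ x → ∃ λ n → x < n ×ₙ a
  archimedean {a} 0<a x with em {∃ λ n → x < n ×ₙ a}
  ... | yes found = found
  ... | no  none  = ⊥-elim (≤⇒≯ s≤s-a (x<y+z⇒x-z<y (x<x+y s 0<a)))
    where
    Multiple : Pred R 0ℓ
    Multiple y = ∃ λ n → y ≈ n ×ₙ a

    bounded : IsUpperBound Multiple x
    bounded y (n , y≈na) = ≮⇒≥ λ x<y → none (n , <-respʳ y≈na x<y)

    sup : ∃ λ s → IsUpperBound Multiple s × (∀ u → IsUpperBound Multiple u → s ≤ u)
    sup = complete Multiple (0# , 0 , refl) (x , bounded)

    s : R
    s = proj₁ sup

    s≤s-a : s ≤ s - a
    s≤s-a = proj₂ (proj₂ sup) (s - a) λ { y (n , y≈na) →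
      x+y≤z⇒x≤z-y (proj₁ (proj₂ sup) (y + a)
        (ℕ.suc n , trans (+-congʳ y≈na) (+-comm (n ×ₙ a) a))) }

  ·-⊖ : ∀ x m n → (m ⊖ n) · x ≈ m ×ₙ x - n ×ₙ x
  ·-⊖ x m ℕ.zero = sym (trans (+-congˡ -0#≈0#) (+-identityʳ (m ×ₙ x)))
  ·-⊖ x ℕ.zero (ℕ.suc n) = sym (+-identityˡ _)
  ·-⊖ x (ℕ.suc m) (ℕ.suc n) rewrite ℤₚ.[1+m]⊖[1+n]≡m⊖n m n = begin
    (m ⊖ n) · x                        ≈⟨ ·-⊖ x m n ⟩
    m ×ₙ x - n ×ₙ x                    ≈⟨ +-identityˡ _ ⟨
    0# + (m ×ₙ x - n ×ₙ x)             ≈⟨ +-congʳ (-‿inverseʳ x) ⟨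
    (x - x) + (m ×ₙ x - n ×ₙ x)        ≈⟨ interchange _ _ _ _ ⟩
    (x + m ×ₙ x) + (- x - n ×ₙ x)      ≈⟨ +-congˡ (-‿+-comm x (n ×ₙ x)) ⟩
    (x + m ×ₙ x) - (x + n ×ₙ x)        ∎

  ·-homo-+ : ∀ x m n → (m ℤ.+ n) · x ≈ m · x + n · x
  ·-homo-+ x (+ m)    (+ n)    = ×ₙ-homo-+ x m n
  ·-homo-+ x (+ m)    -[1+ n ] = ·-⊖ x m (ℕ.suc n)
  ·-homo-+ x -[1+ m ] (+ n)    = trans (·-⊖ x n (ℕ.suc m)) (+-comm _ _)
  ·-homo-+ x -[1+ m ] -[1+ n ] = begin
    - (x + (x + (m ℕ.+ n) ×ₙ x))         ≈⟨ -‿cong (+-congˡ (+-congˡ (×ₙ-homo-+ x m n))) ⟩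
    - (x + (x + (m ×ₙ x + n ×ₙ x)))      ≈⟨ -‿cong (+-congˡ (sym (+-assoc x _ _))) ⟩
    - (x + (x + m ×ₙ x + n ×ₙ x))        ≈⟨ -‿cong (+-congˡ (+-congʳ (+-comm x _))) ⟩
    - (x + (m ×ₙ x + x + n ×ₙ x))        ≈⟨ -‿cong (+-congˡ (+-assoc _ x _)) ⟩
    - (x + (m ×ₙ x + (x + n ×ₙ x)))      ≈⟨ -‿cong (sym (+-assoc x _ _)) ⟩
    - (x + m ×ₙ x + (x + n ×ₙ x))        ≈⟨ -‿+-comm _ _ ⟨
    - (x + m ×ₙ x) - (x + n ×ₙ x)        ∎

  ·-neg : ∀ x n → (ℤ.- n) · x ≈ - (n · x)
  ·-neg x (+ ℕ.zero)  = sym -0#≈0#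
  ·-neg x (+ ℕ.suc n) = refl
  ·-neg x -[1+ n ]    = sym (-‿involutive _)

------------------------------------------------------------------------
-- The circles 𝕊_L

module Circles (em : ExcludedMiddle 0ℓ) (ℝ : RealField) where

  open RealField ℝ renaming (Carrier to R)
  open RealProperties em ℝ
  open RingProperties ring using (-‿+-comm; -0#≈0#)
  open CommutativeSemigroupProperties +-commutativeSemigroup using (interchange)
  open SetoidReasoning setoid

  -- The elements of (2,∞].
  data Length : Set where
    finite : (L : R) → 1# + 1# < L → Length
    ∞      : Length

  0<2 : 0# < 1# + 1#
  0<2 = <-trans 0<1 (x<x+y 1# 0<1)

  -- ℝ/Lℤ is the setoid on R with the equality x + Lℤ = y + Lℤ, so the class
  -- [x] of a real x is x itself.
  infix 4 _≈[_]_

  _≈[_]_ : R → Length → R → Set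
  x ≈[ finite L _ ] y = ∃ λ (n : ℤ) → x ≈ y + n · L
  x ≈[ ∞ ]          y = x ≈ y

  ≈⇒≈[] : ∀ L {x y} → x ≈ y → x ≈[ L ] y
  ≈⇒≈[] (finite L _) x≈y = + 0 , trans x≈y (sym (+-identityʳ _))
  ≈⇒≈[] ∞            x≈y = x≈y

  ≈[]-sym : ∀ L {x y} → x ≈[ L ] y → y ≈[ L ] x
  ≈[]-sym (finite L _) {x} {y} (n , x≈y+nL) = ℤ.- n , (begin
    y                       ≈⟨ x+y-y≈x y (n · L) ⟨
    y + n · L - n · L       ≈⟨ +-cong x≈y+nL (·-neg L n) ⟨
    x + (ℤ.- n) · L         ∎)
  ≈[]-sym ∞ = sym

  ≈[]-trans : ∀ L {x y z} → x ≈[ L ] y → y ≈[ L ] z → x ≈[ L ] z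
  ≈[]-trans (finite L _) {x} {y} {z} (m , p) (n , q) = n ℤ.+ m , (begin
    x                       ≈⟨ p ⟩
    y + m · L               ≈⟨ +-congʳ q ⟩
    z + n · L + m · L       ≈⟨ +-assoc z _ _ ⟩
    z + (n · L + m · L)     ≈⟨ +-congˡ (·-homo-+ L n m) ⟨
    z + (n ℤ.+ m) · L       ∎)
  ≈[]-trans ∞ = trans

  ≈[]-isEquivalence : ∀ L → IsEquivalence (_≈[ L ]_)
  ≈[]-isEquivalence L = record
    { refl = ≈⇒≈[] L refl ; sym = ≈[]-sym L ; trans = ≈[]-trans L }

  +-cong-[] : ∀ L {x y u v} → x ≈[ L ] y → u ≈[ L ] v → x + u ≈[ L ] y + v
  +-cong-[] (finite L _) {x} {y} {u} {v} (m , p) (n , q) = m ℤ.+ n , (begin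
    x + u                       ≈⟨ +-cong p q ⟩
    (y + m · L) + (v + n · L)   ≈⟨ interchange _ _ _ _ ⟩
    (y + v) + (m · L + n · L)   ≈⟨ +-congˡ (·-homo-+ L m n) ⟨
    (y + v) + (m ℤ.+ n) · L     ∎)
  +-cong-[] ∞ = +-cong

  -‿cong-[] : ∀ L {x y} → x ≈[ L ] y → - x ≈[ L ] - y
  -‿cong-[] (finite L _) {x} {y} (n , p) = ℤ.- n , (begin
    - x                     ≈⟨ -‿cong p ⟩
    - (y + n · L)           ≈⟨ -‿+-comm y (n · L) ⟨
    - y - n · L             ≈⟨ +-congˡ (·-neg L n) ⟨
    - y + (ℤ.- n) · L       ∎)
  -‿cong-[] ∞ = -‿cong

  circleGroup : Length → AbelianGroup 0ℓ 0ℓ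
  circleGroup L = record
    { Carrier = R
    ; _≈_     = _≈[ L ]_
    ; _∙_     = _+_
    ; ε       = 0#
    ; _⁻¹     = -_
    ; isAbelianGroup = record
      { isGroup = record
        { isMonoid = record
          { isSemigroup = record
            { isMagma = record
              { isEquivalence = ≈[]-isEquivalence L
              ; ∙-cong        = +-cong-[] L
              }
            ; assoc = λ x y z → ≈⇒≈[] L (+-assoc x y z)
            }
          ; identity = (λ x → ≈⇒≈[] L (+-identityˡ x)) , (λ x → ≈⇒≈[] L (+-identityʳ x))
          }
        ; inverse = (λ x → ≈⇒≈[] L (-‿inverseˡ x)) , (λ x → ≈⇒≈[] L (-‿inverseʳ x))
        ; ⁻¹-cong = -‿cong-[] L
        }
      ; comm = λ x y → ≈⇒≈[] L (+-comm x y)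
      }
    }

  𝕊 : Length → Setoid 0ℓ 0ℓ
  𝕊 L = AbelianGroup.setoid (circleGroup L)

  infixl 6 _+[_]_

  _+[_]_ : R → Length → R → R
  a +[ L ] b = AbelianGroup._∙_ (circleGroup L) a b

  reduce≥0 : ∀ {L} → 0# < L → ∀ n x → 0# ≤ x → x < n ×ₙ L →
             ∃ λ r → 0# ≤ r × r < L × (∃ λ k → r ≈ x + k · L)
  reduce≥0 0<L ℕ.zero x 0≤x x<0 = ⊥-elim (≤⇒≯ 0≤x x<0)
  reduce≥0 {L} 0<L (ℕ.suc n) x 0≤x x<L+nL with compare x L
  ... | tri< x<L _ _ = x , 0≤x , x<L , + 0 , sym (+-identityʳ x)
  ... | tri≈ _ x≈L _ = 0# , inj₂ refl , 0<L , -[1+ 0 ] , (begin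
    0#                ≈⟨ -‿inverseʳ L ⟨
    L - L             ≈⟨ +-cong (sym x≈L) (-‿cong (sym (+-identityʳ L))) ⟩
    x - (L + 0#)      ∎)
  ... | tri> _ _ L<x
    with reduce≥0 0<L n (x - L)
           (inj₁ (<-respˡ (-‿inverseʳ L) (+-monoˡ-< (- L) L<x)))
           (x<y+z⇒x-z<y (<-respʳ (+-comm L (n ×ₙ L)) x<L+nL))
  ... | r , 0≤r , r<L , k , r≈ = r , 0≤r , r<L , -[1+ 0 ] ℤ.+ k , (begin
    r                               ≈⟨ r≈ ⟩
    x - L + k · L                   ≈⟨ +-assoc x _ _ ⟩
    x + (- L + k · L)               ≈⟨ +-congˡ (+-congʳ (-‿cong (+-identityʳ L))) ⟨
    x + (- (L + 0#) + k · L)        ≈⟨ +-congˡ (·-homo-+ L -[1+ 0 ] k) ⟨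
    x + (-[1+ 0 ] ℤ.+ k) · L        ∎)

  -- [0,L), and all of ℝ for L = ∞.
  InFundamentalDomain : Length → R → Set
  InFundamentalDomain (finite L _) x = 0# ≤ x × x < L
  InFundamentalDomain ∞            x = ⊤

  representative : ∀ L a → ∃ λ x → InFundamentalDomain L x × x ≈[ L ] a
  representative ∞ a = a , tt , refl
  representative (finite L 2<L) a
    with archimedean (<-trans 0<2 2<L) (- a)
  ... | m , -a<mL with archimedean (<-trans 0<2 2<L) (a + m ×ₙ L)
  ... | n , y<nL with reduce≥0 (<-trans 0<2 2<L) n (a + m ×ₙ L) 0≤y y<nL
    where
    0≤y : 0# ≤ a + m ×ₙ L
    0≤y = inj₁ (<-respˡ (-‿inverseʳ a) (+-monoʳ-< a -a<mL))
  ... | r , 0≤r , r<L , k , r≈ =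
    r , (0≤r , r<L) , ≈[]-trans (finite L 2<L) (k , r≈) (+ m , refl)

  domain-unique : ∀ L {x y} → InFundamentalDomain L x → InFundamentalDomain L y →
                  x ≈[ L ] y → x ≈ y
  domain-unique ∞ _ _ x≈y = x≈y
  domain-unique (finite L 2<L) {x} {y} (0≤x , x<L) (0≤y , y<L) (n , x≈y+nL) = go n x≈y+nL
    where
    0<L : 0# < L
    0<L = <-trans 0<2 2<L

    too-far : ∀ {u v} k → 0# ≤ v → u < L → ¬ (u ≈ v + ℕ.suc k ×ₙ L)
    too-far {u} {v} k 0≤v u<L u≈ = ≤⇒≯ L≤u u<L
      where
      L≤L+kL : L ≤ L + k ×ₙ L
      L≤L+kL with 0≤×ₙ 0<L k
      ... | inj₁ 0<kL = inj₁ (x<x+y L 0<kL)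
      ... | inj₂ 0≈kL = inj₂ (trans (sym (+-identityʳ L)) (+-congˡ 0≈kL))

      L≤u : L ≤ u
      L≤u with +-monoˡ-≤ (L + k ×ₙ L) 0≤v
      ... | inj₁ p = inj₁ (≤-<-trans L≤L+kL (<-respˡ (+-identityˡ _) (<-respʳ (sym u≈) p)))
      ... | inj₂ p with L≤L+kL
      ...   | inj₁ q = inj₁ (<-respʳ (trans (sym (+-identityˡ _)) (trans p (sym u≈))) q)
      ...   | inj₂ q = inj₂ (trans q (trans (sym (+-identityˡ _)) (trans p (sym u≈))))

    go : ∀ n → x ≈ y + n · L → x ≈ y
    go (+ ℕ.zero)  p = trans p (+-identityʳ y)
    go (+ ℕ.suc k) p = ⊥-elim (too-far k 0≤y x<L p)
    go -[1+ k ]    p =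
      ⊥-elim (too-far k 0≤x y<L (sym (trans (+-congʳ p) (x-y+y≈x y (ℕ.suc k ×ₙ L)))))

  rep : Length → R → R
  rep L a = proj₁ (representative L a)

  rep-cong : ∀ L {a b} → a ≈[ L ] b → rep L a ≈ rep L b
  rep-cong L {a} {b} a≈b with representative L a | representative L b
  ... | x , x∈ , x≈a | y , y∈ , y≈b =
    domain-unique L x∈ y∈ (≈[]-trans L x≈a (≈[]-trans L a≈b (≈[]-sym L y≈b)))

  d : Length → R → R → R
  d L@(finite ℓ _) a b = ∣ rep L a - rep L b ∣ ⊓ (ℓ - ∣ rep L a - rep L b ∣)
  d ∞              a b = ∣ a - b ∣

  module _ (L : Length) where

    Circular : (a b c : R) → Set
    Circular a b c = (x < y × y < z) ⊎ (y < z × z < x) ⊎ (z < x × x < y)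
      where
      x = rep L a
      y = rep L b
      z = rep L c

    Circular-resp : ∀ {a a′ b b′ c c′} → a ≈[ L ] a′ → b ≈[ L ] b′ → c ≈[ L ] c′ →
                    Circular a b c → Circular a′ b′ c′
    Circular-resp a≈ b≈ c≈ = λ
      { (inj₁ (p , q))        → inj₁ (resp a≈ b≈ p , resp b≈ c≈ q)
      ; (inj₂ (inj₁ (p , q))) → inj₂ (inj₁ (resp b≈ c≈ p , resp c≈ a≈ q))
      ; (inj₂ (inj₂ (p , q))) → inj₂ (inj₂ (resp c≈ a≈ p , resp a≈ b≈ q))
      }
      where
      resp : ∀ {u u′ v v′} → u ≈[ L ] u′ → v ≈[ L ] v′ →
             rep L u < rep L v → rep L u′ < rep L v′
      resp u≈ v≈ p = <-respˡ (rep-cong L u≈) (<-respʳ (rep-cong L v≈) p)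

    -- For L = ∞ the congruence modulo L is equality of reals.
    IntegerDistanceFree : Subset (𝕊 L) → Set
    IntegerDistanceFree S =
      ¬ (∃ λ (u : Point S) → ∃ λ (v : Point S) → ∃ λ (n : ℤ) →
           ¬ (proj₁ u ≈[ L ] proj₁ v) × d L (proj₁ u) (proj₁ v) ≈[ L ] fromℤ n)

    record IsGECCircleGraph (S : Subset (𝕊 L)) (G : Graph (points S)) : Set where
      field
        dense               : IsDense ℝ (d L) S
        integerDistanceFree : IntegerDistanceFree S
        gec                 : IsGEC ℝ (d L) S G

    structureGC : (S : Subset (𝕊 L)) → Graph (points S) → Structure ℒGC
    structureGC S G = record
      { domain  = points S
      ; ⟦_⟧     = λ
        { E         (u ∷ v ∷ [])     → Adj u v
        ; (C z t k) (a ∷ b ∷ c ∷ []) →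
            Circular (proj₁ a +[ L ] fromℤ z) (proj₁ b +[ L ] fromℤ t) (proj₁ c +[ L ] fromℤ k)
        }
      ; ⟦⟧-resp = λ
        { E         (p ∷ q ∷ [])     → λ uv → proj₁ Adj-resp q (proj₂ Adj-resp p uv)
        ; (C z t k) (p ∷ q ∷ r ∷ []) →
            Circular-resp (shift z p) (shift t q) (shift k r)
        }
      }
      where
      open Graph G
      shift : ∀ z {a b} → a ≈[ L ] b → a +[ L ] fromℤ z ≈[ L ] b +[ L ] fromℤ z
      shift z p = +-cong-[] L p (≈⇒≈[] L refl)

    -- The sentences true in every g.e.c. graph on a dense integer-distance free
    -- subset of the circle.
    commonTheory : Theory ℒGC
    commonTheory σ = ∀ (S : Subset (𝕊 L)) (G : Graph (points S)) →
                     IsGECCircleGraph S G → structureGC S G ⊨ σ [ [] ]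

{-# OPTIONS --safe #-}
module Submission where

-- Relative to a finite set of symbols C z t k, a new vertex x is located by the
-- shortest arc around it whose endpoints are among the finitely many points
-- y + m, where y is an old vertex and m a small integer. Whether x is
-- less than 1 away from y is decided by this arc, because it says whether x lies
-- between y − 1 and y + 1. The corresponding arc of the other graph is a
-- nonempty open interval, so density and the extension property place in it a
-- vertex with prescribed neighbours. This is a back-and-forth system that
-- consumes finitely many symbols per quantifier; hence every formula is
-- invariant under agreement on a finite set of atomic formulas, and it is
-- equivalent to the disjunction of the finitely many agreement classes that
-- satisfy it.

open import Level using (0ℓ)
open import Algebra.Bundles using (CommutativeRing)
import Algebra.Construct.NaturalChoice.Max as Max
import Algebra.Construct.NaturalChoice.Min as Min
import Algebra.Properties.Ring as RingProperties
import Algebra.Properties.Semiring.Mult as SemiringMult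
import Algebra.Solver.Ring
open import Algebra.Solver.Ring.AlmostCommutativeRing using (fromCommutativeRing; _-Raw-AlmostCommutative⟶_)
open import Axiom.ExcludedMiddle using (ExcludedMiddle)
open import Data.Empty using (⊥-elim)
open import Data.Fin.Base using (Fin; zero; suc)
open import Data.Integer.Base as ℤ using (ℤ; +_; -[1+_])
import Data.Integer.Properties as ℤₚ
open import Data.List.Base
  using (List; []; _∷_; _++_; map; concatMap; cartesianProductWith; cartesianProduct; allFin; filter)
open import Data.List.Membership.Propositional using (_∈_; find; lose)
open import Data.List.Membership.Propositional.Properties
  using (∈-++⁺ˡ; ∈-++⁺ʳ; ∈-++⁻; ∈-map⁺; ∈-map⁻; ∈-concatMap⁺; ∈-concatMap⁻; ∈-cartesianProductWith⁺;
         ∈-cartesianProductWith⁻; ∈-cartesianProduct⁺; ∈-cartesianProduct⁻; ∈-allFin; ∈-filter⁺)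
open import Data.List.Relation.Binary.Subset.Propositional using (_⊆_)
open import Data.List.Relation.Unary.All as All using (All; []; _∷_)
import Data.List.Relation.Unary.All.Properties as All
open import Data.List.Relation.Unary.Any using (Any; here; there)
open import Data.Maybe.Base using (Maybe; just; nothing)
open import Data.Nat.Base as ℕ using (ℕ)
open import Data.Product.Base using (∃; ∃₂; Σ; _×_; _,_; proj₁; proj₂)
open import Data.Sum.Base as Sum using (_⊎_; inj₁; inj₂)
import Data.Vec.Base as Vec
open import Data.Vec.Base using (Vec; []; _∷_; lookup)
open import Data.Vec.Relation.Binary.Pointwise.Inductive as Pointwise using (Pointwise; []; _∷_)
open import Function.Base using (_∘_; id)
open import Function.Bundles using (_⇔_; mk⇔; Equivalence)
open import Relation.Binary.Core using (Rel)
open import Relation.Binary.Definitions using (Tri; tri<; tri≈; tri>)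
open import Relation.Binary.PropositionalEquality as ≡ using (_≡_; subst)
import Relation.Binary.Reasoning.Setoid as SetoidReasoning
open import Relation.Binary.Structures using (IsEquivalence)
open import Relation.Nullary.Decidable.Core using (Dec; yes; no)
open import Relation.Nullary.Negation.Core using (¬_)
open import Defs

open Equivalence using (to; from)

-- Back-and-forth systems and quantifier elimination

-- Two arcs can be compared across the graphs only if coincidences between shifted old vertices
-- `y + m` and `z + k` agree, and such a coincidence is not an atomic formula. Integer-distance
-- freeness settles it: a coincidence forces `y = z`, and then it is a congruence between `m` and
-- `k` modulo L, the same in both graphs. It also keeps a new vertex off every shifted old one, so
-- that it lies inside an arc. The hypothesis L > 2 makes the open unit ball around `y` the arc from
-- `y − 1` to `y + 1`. Atomic formulas may shift the new vertex too; translations and reflections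
-- carry such shifts over to the old vertices, where they become differences of shifts. Hence one
-- quantifier demands agreement on more shifts than its body mentions, but still on finitely many.

⇔-sym : ∀ {A B : Set} → A ⇔ B → B ⇔ A
⇔-sym e = mk⇔ (from e) (to e)

⇔-trans : ∀ {A B C : Set} → A ⇔ B → B ⇔ C → A ⇔ C
⇔-trans e f = mk⇔ (to f ∘ to e) (from e ∘ from f)

module _ {ℒ : Language} where

  open Language ℒ

  record Agree (Σ : List Symbol) (M N : Structure ℒ) {n : ℕ}
               (ρ : Vec (Structure.Carrier M) n) (ρ′ : Vec (Structure.Carrier N) n) : Set where
    private
      module M = Structure M
      module N = Structure N
    field
      ≐⇔   : ∀ i j → lookup ρ i M.≈ lookup ρ j ⇔ lookup ρ′ i N.≈ lookup ρ′ j
      rel⇔ : ∀ {r} → r ∈ Σ → ∀ is → M.⟦ r ⟧ (Vec.map (lookup ρ) is) ⇔ N.⟦ r ⟧ (Vec.map (lookup ρ′) is)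

  open Agree public

  Agree-sym : ∀ {M N Σ n} {ρ : Vec (Structure.Carrier M) n} {ρ′} → Agree Σ M N ρ ρ′ → Agree Σ N M ρ′ ρ
  Agree-sym e .≐⇔ i j    = ⇔-sym (e .≐⇔ i j)
  Agree-sym e .rel⇔ r is = ⇔-sym (e .rel⇔ r is)

  Agree-⊆ : ∀ {M N Σ Σ′ n} {ρ : Vec (Structure.Carrier M) n} {ρ′} →
            Σ ⊆ Σ′ → Agree Σ′ M N ρ ρ′ → Agree Σ M N ρ ρ′
  Agree-⊆ Σ⊆Σ′ e .≐⇔     = e .≐⇔
  Agree-⊆ Σ⊆Σ′ e .rel⇔ r = e .rel⇔ (Σ⊆Σ′ r)

  identify : ∀ {n} → Fin n → Fin (ℕ.suc n) → Fin n
  identify i zero    = i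
  identify i (suc j) = j

  module Identify (M : Structure ℒ) {n} (i : Fin n) {ρ : Vec (Structure.Carrier M) n} {x}
                  (x≈ρi : Structure._≈_ M x (lookup ρ i)) where
    open Structure M

    lookup-identify : ∀ j → lookup (x ∷ ρ) j ≈ lookup ρ (identify i j)
    lookup-identify zero    = x≈ρi
    lookup-identify (suc j) = refl

    map-identify : ∀ {k} (is : Vec (Fin (ℕ.suc n)) k) →
                   Pointwise _≈_ (Vec.map (lookup (x ∷ ρ)) is) (Vec.map (lookup ρ) (Vec.map (identify i) is))
    map-identify []       = []
    map-identify (j ∷ is) = lookup-identify j ∷ map-identify is

    ≐-identify : ∀ j k → lookup (x ∷ ρ) j ≈ lookup (x ∷ ρ) k ⇔ lookup ρ (identify i j) ≈ lookup ρ (identify i k)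
    ≐-identify j k = mk⇔
      (λ p → trans (sym (lookup-identify j)) (trans p (lookup-identify k)))
      (λ p → trans (lookup-identify j) (trans p (sym (lookup-identify k))))

    rel-identify : ∀ r is → ⟦ r ⟧ (Vec.map (lookup (x ∷ ρ)) is) ⇔
                            ⟦ r ⟧ (Vec.map (lookup ρ) (Vec.map (identify i) is))
    rel-identify r is = mk⇔ (⟦⟧-resp r (map-identify is)) (⟦⟧-resp r (Pointwise.sym sym (map-identify is)))

  -- Substituting the variable of the repeated entry for the newest one turns each atomic formula on
  -- the longer tuple into one on `ρ` with the same symbol, so no symbols are consumed.
  Agree-duplicate : ∀ {M N Σ n} {ρ : Vec (Structure.Carrier M) n} {ρ′ x} i → Agree Σ M N ρ ρ′ →
                    Structure._≈_ M x (lookup ρ i) → Agree Σ M N (x ∷ ρ) (lookup ρ′ i ∷ ρ′)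
  Agree-duplicate {M} {N} {ρ = ρ} {ρ′} {x} i e x≈ = record
    { ≐⇔   = λ j k → ⇔-trans (M.≐-identify j k) (⇔-trans (e .≐⇔ _ _) (⇔-sym (N.≐-identify j k)))
    ; rel⇔ = λ {r} r∈ is →
        ⇔-trans (M.rel-identify r is) (⇔-trans (e .rel⇔ r∈ _) (⇔-sym (N.rel-identify r is)))
    }
    where
    module M = Identify M i {ρ} {x} x≈
    module N = Identify N i {ρ′} (Structure.refl N)

  closure : ∀ {n} → Formula ℒ n → Sentence ℒ
  closure {ℕ.zero}  φ = φ
  closure {ℕ.suc n} φ = closure (∀̇ φ)

  closure-intro : ∀ M {n} (φ : Formula ℒ n) → (∀ ρ → M ⊨ φ [ ρ ]) → M ⊨ closure φ [ [] ]
  closure-intro M {ℕ.zero}  φ h = h []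
  closure-intro M {ℕ.suc n} φ h = closure-intro M (∀̇ φ) (λ ρ x → h (x ∷ ρ))

  closure-elim : ∀ M {n} (φ : Formula ℒ n) → M ⊨ closure φ [ [] ] → ∀ ρ → M ⊨ φ [ ρ ]
  closure-elim M {ℕ.zero}  φ h []      = h
  closure-elim M {ℕ.suc n} φ h (x ∷ ρ) = closure-elim M (∀̇ φ) h ρ x

  -- Entailment ranges over all models of `T`, including those outside the family, and over
  -- assignments, while `T` holds sentences only. The universal closure is a sentence true
  -- throughout the family, so it belongs to `T`, and every model inherits it.
  ∀⊨⇒Entails : {T : Theory ℒ} {I : Set₁} (𝓜 : I → Structure ℒ) →
               (∀ σ → (∀ i → 𝓜 i ⊨ σ [ [] ]) → T σ) →
               ∀ {n} (φ : Formula ℒ n) → (∀ i ρ → 𝓜 i ⊨ φ [ ρ ]) → Entails T φ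
  ∀⊨⇒Entails 𝓜 ⇒T φ h M M⊨T =
    closure-elim M φ (M⊨T (closure φ) (⇒T (closure φ) λ i → closure-intro (𝓜 i) φ (h i)))

  -- Quantifier-free descriptions of agreement classes

  data Atomic {n} : Formula ℒ n → Set where
    _≐_ : ∀ i j → Atomic (i ≐ j)
    rel : ∀ r is → Atomic (rel r is)

  Atomic⇒QuantifierFree : ∀ {n} {φ : Formula ℒ n} → Atomic φ → QuantifierFree φ
  Atomic⇒QuantifierFree (i ≐ j)    = i ≐ j
  Atomic⇒QuantifierFree (rel r is) = rel r is

  vectors : ∀ {A : Set} → List A → ∀ k → List (Vec A k)
  vectors xs ℕ.zero    = [] ∷ []
  vectors xs (ℕ.suc k) = cartesianProductWith _∷_ xs (vectors xs k)

  ∈-vectors : ∀ {n k} (is : Vec (Fin n) k) → is ∈ vectors (allFin n) k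
  ∈-vectors []       = here ≡.refl
  ∈-vectors (i ∷ is) = ∈-cartesianProductWith⁺ _∷_ (∈-allFin i) (∈-vectors is)

  AtomicFormula : ℕ → Set
  AtomicFormula n = ∃ (Atomic {n})

  relations : ∀ n → Symbol → List (AtomicFormula n)
  relations n r = map (λ is → _ , rel r is) (vectors (allFin n) (arity r))

  atoms : List Symbol → ∀ n → List (AtomicFormula n)
  atoms Σ n = cartesianProductWith (λ i j → _ , i ≐ j) (allFin n) (allFin n) ++ concatMap (relations n) Σ

  atoms⇒Agree : ∀ {Σ M N n} {ρ : Vec (Structure.Carrier M) n} {ρ′} →
                All (λ δ → M ⊨ proj₁ δ [ ρ ] ⇔ N ⊨ proj₁ δ [ ρ′ ]) (atoms Σ n) → Agree Σ M N ρ ρ′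
  atoms⇒Agree {n = n} h .≐⇔ i j =
    All.lookup h (∈-++⁺ˡ (∈-cartesianProductWith⁺ (λ i j → _ , i ≐ j) (∈-allFin i) (∈-allFin j)))
  atoms⇒Agree {n = n} h .rel⇔ {r} r∈ is =
    All.lookup h (∈-++⁺ʳ _ (∈-concatMap⁺ (relations n) (lose r∈ (∈-map⁺ (λ is → _ , rel r is) (∈-vectors is)))))

  Agree⇒atoms : ∀ {Σ M N n} {ρ : Vec (Structure.Carrier M) n} {ρ′} → Agree Σ M N ρ ρ′ →
                All (λ δ → M ⊨ proj₁ δ [ ρ ] ⇔ N ⊨ proj₁ δ [ ρ′ ]) (atoms Σ n)
  Agree⇒atoms {Σ} {M} {N} {n} {ρ} {ρ′} e = All.tabulate agree
    where
    agree : ∀ {δ} → δ ∈ atoms Σ n → M ⊨ proj₁ δ [ ρ ] ⇔ N ⊨ proj₁ δ [ ρ′ ]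
    agree δ∈ with ∈-++⁻ (cartesianProductWith (λ i j → _ , i ≐ j) (allFin n) (allFin n)) δ∈
    ... | inj₁ ≐∈ with ∈-cartesianProductWith⁻ (λ i j → _ , i ≐ j) (allFin n) (allFin n) ≐∈
    ...   | i , j , _ , _ , ≡.refl = e .≐⇔ i j
    agree δ∈ | inj₂ rel∈ with find (∈-concatMap⁻ (relations n) {xs = Σ} rel∈)
    ...   | r , r∈ , δ∈r with ∈-map⁻ (λ is → _ , rel r is) δ∈r
    ...     | is , _ , ≡.refl = e .rel⇔ r∈ is

  -- A quantifier-free formula satisfied by exactly the tuples that agree on Δ
  -- with some element of P.
  describe : ExcludedMiddle 0ℓ → ∀ {n} {V : Set} → (V → Formula ℒ n → Set) → List (AtomicFormula n) →
             (V → Set) → Formula ℒ n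
  describe em holds [] P with em {∃ P}
  ... | yes _ = ¬̇ ⊥̇
  ... | no  _ = ⊥̇
  describe em holds ((δ , _) ∷ Δ) P =
    (δ ∧̇ describe em holds Δ (λ v → P v × holds v δ)) ∨̇
    ((¬̇ δ) ∧̇ describe em holds Δ (λ v → P v × ¬ holds v δ))

  module _ (em : ExcludedMiddle 0ℓ) {n} {V : Set} (holds : V → Formula ℒ n → Set) where

    describe-quantifierFree : ∀ Δ P → QuantifierFree (describe em holds Δ P)
    describe-quantifierFree [] P with em {∃ P}
    ... | yes _ = ⊥̇ ⇒̇ ⊥̇
    ... | no  _ = ⊥̇
    describe-quantifierFree ((δ , at) ∷ Δ) P =
      (Atomic⇒QuantifierFree at ∧̇ describe-quantifierFree Δ _) ∨̇
      ((Atomic⇒QuantifierFree at ⇒̇ ⊥̇) ∧̇ describe-quantifierFree Δ _)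

    -- A true branch fixes a sign for each atom of `Δ`. The predicate that has accumulated at its
    -- leaf puts the same signs on `v`, and the leaf is true only if such a `v` exists.
    describe-sound : ∀ (M : Structure ℒ) ρ Δ P → M ⊨ describe em holds Δ P [ ρ ] →
                     ∃ λ v → P v × All (λ δ → holds v (proj₁ δ) ⇔ M ⊨ proj₁ δ [ ρ ]) Δ
    describe-sound M ρ [] P h with em {∃ P}
    ... | yes (v , Pv) = v , Pv , []
    ... | no  _        = ⊥-elim h
    describe-sound M ρ (_ ∷ Δ) P (inj₁ (δρ , h)) with describe-sound M ρ Δ _ h
    ... | v , (Pv , δv) , hs = v , Pv , mk⇔ (λ _ → δρ) (λ _ → δv) ∷ hs
    describe-sound M ρ (_ ∷ Δ) P (inj₂ (¬δρ , h)) with describe-sound M ρ Δ _ h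
    ... | v , (Pv , ¬δv) , hs = v , Pv , mk⇔ (⊥-elim ∘ ¬δv) (⊥-elim ∘ ¬δρ) ∷ hs

    describe-complete : ∀ (M : Structure ℒ) ρ Δ (P : V → Set) v → P v →
                        All (λ δ → holds v (proj₁ δ) ⇔ M ⊨ proj₁ δ [ ρ ]) Δ →
                        M ⊨ describe em holds Δ P [ ρ ]
    describe-complete M ρ [] P v Pv [] with em {∃ P}
    ... | yes _  = id
    ... | no ¬∃P = ¬∃P (v , Pv)
    describe-complete M ρ ((δ , _) ∷ Δ) P v Pv (e ∷ es) with em {holds v δ}
    ... | yes δv = inj₁ (to e δv , describe-complete M ρ Δ _ v (Pv , δv) es)
    ... | no ¬δv = inj₂ (¬δv ∘ from e , describe-complete M ρ Δ _ v (Pv , ¬δv) es)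

-- Only the forth half is required: the back half is `extend` with `i` and `j` exchanged. `refine`
-- is the price of one quantifier: agreement on `refine Σ` buys one more entry, with agreement on
-- `Σ` left over.
module BackAndForth
  {ℒ : Language} {I : Set₁} (𝓜 : I → Structure ℒ)
  (start  : ∀ Σ i j → Agree Σ (𝓜 i) (𝓜 j) [] [])
  (refine : List (Language.Symbol ℒ) → List (Language.Symbol ℒ))
  (extend : ∀ Σ i j {n} (ρ : Vec (Structure.Carrier (𝓜 i)) n) ρ′ → Agree (refine Σ) (𝓜 i) (𝓜 j) ρ ρ′ →
            ∀ x → ∃ λ x′ → Agree Σ (𝓜 i) (𝓜 j) (x ∷ ρ) (x′ ∷ ρ′))
  where

  open Language ℒ

  Invariant : List Symbol → ∀ {n} → Formula ℒ n → Set₁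
  Invariant Σ φ = ∀ i j {ρ ρ′} → Agree Σ (𝓜 i) (𝓜 j) ρ ρ′ → 𝓜 i ⊨ φ [ ρ ] → 𝓜 j ⊨ φ [ ρ′ ]

  support : ∀ {n} → Formula ℒ n → List Symbol
  support ⊥̇          = []
  support (i ≐ j)    = []
  support (rel r is) = r ∷ []
  support (φ ⇒̇ ψ)    = support φ ++ support ψ
  support (φ ∧̇ ψ)    = support φ ++ support ψ
  support (φ ∨̇ ψ)    = support φ ++ support ψ
  support (∀̇ φ)      = refine (support φ)
  support (∃̇ φ)      = refine (support φ)

  invariant : ∀ {n} (φ : Formula ℒ n) → Invariant (support φ) φ
  invariant ⊥̇          i j e = id
  invariant (k ≐ l)    i j e = to (e .≐⇔ k l)
  invariant (rel r is) i j e = to (e .rel⇔ (here ≡.refl) is)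
  invariant (φ ⇒̇ ψ)    i j e h p =
    invariant ψ i j (Agree-⊆ (∈-++⁺ʳ (support φ)) e) (h (invariant φ j i (Agree-sym (Agree-⊆ ∈-++⁺ˡ e)) p))
  invariant (φ ∧̇ ψ)    i j e (p , q) =
    invariant φ i j (Agree-⊆ ∈-++⁺ˡ e) p , invariant ψ i j (Agree-⊆ (∈-++⁺ʳ (support φ)) e) q
  invariant (φ ∨̇ ψ)    i j e (inj₁ p) = inj₁ (invariant φ i j (Agree-⊆ ∈-++⁺ˡ e) p)
  invariant (φ ∨̇ ψ)    i j e (inj₂ q) = inj₂ (invariant ψ i j (Agree-⊆ (∈-++⁺ʳ (support φ)) e) q)
  invariant (∀̇ φ)      i j e h x′ with extend (support φ) j i _ _ (Agree-sym e) x′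
  ... | x , e′ = invariant φ i j (Agree-sym e′) (h x)
  invariant (∃̇ φ)      i j e (x , h) with extend (support φ) i j _ _ e x
  ... | x′ , e′ = x′ , invariant φ i j e′ h

  -- Every tuple is imitated in every other structure of the family. So a single structure already
  -- shows all agreement classes.
  realise : ∀ Σ i j {n} (ρ : Vec (Structure.Carrier (𝓜 i)) n) → ∃ λ ρ′ → Agree Σ (𝓜 i) (𝓜 j) ρ ρ′
  realise Σ i j []      = [] , start Σ i j
  realise Σ i j (x ∷ ρ) with realise (refine Σ) i j ρ
  ... | ρ′ , e with extend Σ i j ρ ρ′ e x
  ...   | x′ , e′ = x′ ∷ ρ′ , e′

  elementarilyEquivalent : ∀ i j → ElementarilyEquivalent (𝓜 i) (𝓜 j)
  elementarilyEquivalent i j σ = mk⇔ (invariant σ i j (start _ i j)) (invariant σ j i (start _ j i))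

  module _ (em : ExcludedMiddle 0ℓ) (o : I) {T : Theory ℒ}
           (T⇒ : ∀ σ → T σ → ∀ i → 𝓜 i ⊨ σ [ [] ]) (⇒T : ∀ σ → (∀ i → 𝓜 i ⊨ σ [ [] ]) → T σ) where

    isComplete : IsComplete T
    isComplete = (𝓜 o , λ σ Tσ → T⇒ σ Tσ o) , decide
      where
      decide : ∀ σ → Entails T σ ⊎ Entails T (¬̇ σ)
      decide σ with em {𝓜 o ⊨ σ [ [] ]}
      ... | yes p = inj₁ (∀⊨⇒Entails 𝓜 ⇒T σ λ { i [] → to (elementarilyEquivalent o i σ) p })
      ... | no ¬p = inj₂ (∀⊨⇒Entails 𝓜 ⇒T (¬̇ σ) λ { i [] p → ¬p (from (elementarilyEquivalent o i σ) p) })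

    hasQuantifierElimination : HasQuantifierElimination T
    hasQuantifierElimination {n} φ = ψ , describe-quantifierFree em _ Δ _ , ∀⊨⇒Entails 𝓜 ⇒T (φ ⇔̇ ψ) φ⇔ψ
      where
      Δ : List (AtomicFormula n)
      Δ = atoms (support φ) n

      -- Collecting the classes from the one structure `o` keeps the search in `Set`, where `em`
      -- applies; the index type `I` lives one level higher.
      ψ : Formula ℒ n
      ψ = describe em (λ ρ δ → 𝓜 o ⊨ δ [ ρ ]) Δ (λ ρ → 𝓜 o ⊨ φ [ ρ ])

      φ⇔ψ : ∀ i ρ → 𝓜 i ⊨ (φ ⇔̇ ψ) [ ρ ]
      φ⇔ψ i ρ = φ⇒ψ , ψ⇒φ
        where
        φ⇒ψ : 𝓜 i ⊨ φ [ ρ ] → 𝓜 i ⊨ ψ [ ρ ]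
        φ⇒ψ h with realise (support φ) i o ρ
        ... | ρ₀ , e = describe-complete em _ (𝓜 i) ρ Δ _ ρ₀ (invariant φ i o e h) (Agree⇒atoms (Agree-sym e))

        ψ⇒φ : 𝓜 i ⊨ ψ [ ρ ] → 𝓜 i ⊨ φ [ ρ ]
        ψ⇒φ h with describe-sound em _ (𝓜 i) ρ Δ _ h
        ... | ρ₀ , φρ₀ , es = invariant φ o i (atoms⇒Agree es) φρ₀

-- Real arithmetic

module RealArithmetic (em : ExcludedMiddle 0ℓ) (ℝ : RealField) where

  open RealField ℝ renaming (Carrier to R)
  open RealProperties em ℝ
  open CommutativeRing commutativeRing using (semiring; *-congˡ; distribˡ; distribʳ; *-identityˡ; *-identityʳ)
  open Min ≤-totalOrder using (⊓-sel)
  open Max ≤-totalOrder using (⊔-sel; x≤x⊔y; x≤y⊔x)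
  open SetoidReasoning setoid
  open RingProperties ring using (-‿distribˡ-*; -‿distribʳ-*)

  pos-homo-* : ∀ m n → fromℤ (+ m ℤ.* n) ≈ fromℤ (+ m) * fromℤ n
  pos-homo-* m (+ n) rewrite ≡.sym (ℤₚ.pos-* m n) = SemiringMult.×1-homo-* semiring m n
  pos-homo-* m -[1+ n ] rewrite ≡.sym (ℤₚ.neg-distribʳ-* (+ m) (+ ℕ.suc n)) = begin
    fromℤ (ℤ.- (+ m ℤ.* + ℕ.suc n))      ≈⟨ ·-neg 1# (+ m ℤ.* + ℕ.suc n) ⟩
    - fromℤ (+ m ℤ.* + ℕ.suc n)          ≈⟨ -‿cong (pos-homo-* m (+ ℕ.suc n)) ⟩
    - (fromℤ (+ m) * fromℤ (+ ℕ.suc n))  ≈⟨ -‿distribʳ-* _ _ ⟩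
    fromℤ (+ m) * fromℤ -[1+ n ]         ∎

  fromℤ-homo-* : ∀ m n → fromℤ (m ℤ.* n) ≈ fromℤ m * fromℤ n
  fromℤ-homo-* (+ m)    n = pos-homo-* m n
  fromℤ-homo-* -[1+ m ] n rewrite ≡.sym (ℤₚ.neg-distribˡ-* (+ ℕ.suc m) n) = begin
    fromℤ (ℤ.- (+ ℕ.suc m ℤ.* n))      ≈⟨ ·-neg 1# (+ ℕ.suc m ℤ.* n) ⟩
    - fromℤ (+ ℕ.suc m ℤ.* n)          ≈⟨ -‿cong (pos-homo-* (ℕ.suc m) n) ⟩
    - (fromℤ (+ ℕ.suc m) * fromℤ n)    ≈⟨ -‿distribˡ-* _ _ ⟩
    fromℤ -[1+ m ] * fromℤ n           ∎

  fromℤ≟ : ∀ m n → Maybe (fromℤ m ≈ fromℤ n)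
  fromℤ≟ m n with m ℤₚ.≟ n
  ... | yes ≡.refl = just refl
  ... | no  _      = nothing

  -- Integers serve as coefficients of the ring solver because their equality computes, whereas the
  -- reals are given by axioms.
  fromℤ-morphism : ℤ.+-*-rawRing -Raw-AlmostCommutative⟶ fromCommutativeRing commutativeRing
  fromℤ-morphism = record
    { ⟦_⟧    = fromℤ
    ; +-homo = ·-homo-+ 1#
    ; *-homo = fromℤ-homo-*
    ; -‿homo = ·-neg 1#
    ; 0-homo = refl
    ; 1-homo = +-identityʳ 1#
    }

  open Algebra.Solver.Ring ℤ.+-*-rawRing (fromCommutativeRing commutativeRing) fromℤ-morphism fromℤ≟ public
    using (solve; _:=_; _:+_; _:-_; :-_; con)

  fromℤ-homo-- : ∀ m n → fromℤ (m ℤ.- n) ≈ fromℤ m - fromℤ n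
  fromℤ-homo-- m n = trans (·-homo-+ 1# m (ℤ.- n)) (+-congˡ (·-neg 1# n))

  <⇒≤ : ∀ {x y} → x < y → x ≤ y
  <⇒≤ = inj₁

  ≤-refl : ∀ {x} → x ≤ x
  ≤-refl = inj₂ refl

  +-mono-<-≤ : ∀ {a b c d} → a < b → c ≤ d → a + c < b + d
  +-mono-<-≤ {b = b} {c} a<b (inj₁ c<d) = <-trans (+-monoˡ-< c a<b) (+-monoʳ-< b c<d)
  +-mono-<-≤ {c = c} a<b (inj₂ c≈d) = <-respʳ (+-congˡ c≈d) (+-monoˡ-< c a<b)

  -- The hypothesis says that d − c = b − a.
  rearrange-< : ∀ {a b c d} → a < b → c + b ≈ d + a → c < d
  rearrange-< {a} {b} {c} {d} a<b eq =
    <-respˡ (x+y-y≈x c b) (<-respʳ (x+y-y≈x d b)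
      (+-monoˡ-< (- b) (<-respˡ (sym eq) (+-monoʳ-< d a<b))))

  rearrange-≤ : ∀ {a b c d} → a ≤ b → c + b ≈ d + a → c ≤ d
  rearrange-≤ (inj₁ a<b) eq = inj₁ (rearrange-< a<b eq)
  rearrange-≤ {a} {b} {c} {d} (inj₂ a≈b) eq =
    inj₂ (trans (sym (x+y-y≈x c b)) (trans (+-cong eq (-‿cong (sym a≈b))) (x+y-y≈x d a)))

  half : ∀ {δ} → 0# < δ → ∃ λ η → 0# < η × η < δ
  half {δ} 0<δ with inverse (1# + 1#) (λ 2≈0 → <-irrefl (sym 2≈0) (<-trans 0<1 (x<x+y 1# 0<1)))
  ... | h , 2h≈1 = η , 0<η , <-respʳ η+η≈δ (x<x+y η 0<η)
    where
    η : R
    η = δ * h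

    η+η≈δ : η + η ≈ δ
    η+η≈δ = begin
      δ * h + δ * h                  ≈⟨ distribˡ δ h h ⟨
      δ * (h + h)                    ≈⟨ *-congˡ (+-cong (*-identityˡ h) (*-identityˡ h)) ⟨
      δ * (1# * h + 1# * h)          ≈⟨ *-congˡ (distribʳ h 1# 1#) ⟨
      δ * ((1# + 1#) * h)            ≈⟨ *-congˡ 2h≈1 ⟩
      δ * 1#                         ≈⟨ *-identityʳ δ ⟩
      δ                              ∎

    0<η : 0# < η
    0<η with compare 0# η
    ... | tri< 0<η _ _ = 0<η
    ... | tri≈ _ 0≈η _ =
      ⊥-elim (<-irrefl (trans (sym (+-identityʳ 0#)) (trans (+-cong 0≈η 0≈η) η+η≈δ)) 0<δ)
    ... | tri> _ _ η<0 =
      ⊥-elim (<-irrefl refl (<-trans 0<δ (<-respˡ η+η≈δ (<-respʳ (+-identityʳ 0#) (+-mono-<-≤ η<0 (<⇒≤ η<0))))))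

  between : ∀ {x y} → x < y → ∃ λ m → x < m × m < y
  between {x} {y} x<y
    with half (rearrange-< {x} {y} x<y (solve 2 (λ x y → con (+ 0) :+ y := (y :- x) :+ x) refl x y))
  ... | η , 0<η , η<y-x = x + η , x<x+y x 0<η ,
    rearrange-< η<y-x (solve 3 (λ x y η → (x :+ η) :+ (y :- x) := y :+ η) refl x y η)

  common-bound : ∀ {α β} → 0# < α → 0# < β → ∃ λ ε → 0# < ε × ε ≤ α × ε ≤ β
  common-bound {α} {β} 0<α 0<β with compare α β
  ... | tri< α<β _ _ = α , 0<α , ≤-refl , <⇒≤ α<β
  ... | tri≈ _ α≈β _ = α , 0<α , ≤-refl , inj₂ α≈β
  ... | tri> _ _ β<α = β , 0<β , <⇒≤ β<α , ≤-refl

  ⊓<⇒<⊎< : ∀ {x y z} → x ⊓ y < z → x < z ⊎ y < z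
  ⊓<⇒<⊎< {x} {y} p with ⊓-sel x y
  ... | inj₁ e = inj₁ (<-respˡ e p)
  ... | inj₂ e = inj₂ (<-respˡ e p)

  ∣∣<⇒ : ∀ {x r} → ∣ x ∣ < r → x < r × - x < r
  ∣∣<⇒ {x} p = ≤-<-trans (x≤x⊔y x (- x)) p , ≤-<-trans (x≤y⊔x x (- x)) p

  ∣∣<⇐ : ∀ {x r} → x < r → - x < r → ∣ x ∣ < r
  ∣∣<⇐ {x} p q with ⊔-sel x (- x)
  ... | inj₁ e = <-respˡ (sym e) p
  ... | inj₂ e = <-respˡ (sym e) q

-- Circular orders

-- Strict cyclic orders up to a setoid equality. They are asymmetric: `transitive` turns `C a b c`
-- and `C a c b` into `C a b b`, which contradicts `irrefl` after a rotation.
record IsCircularOrder {A : Set} (_∼_ : Rel A 0ℓ) (C : A → A → A → Set) : Set where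
  field
    isEquivalence : IsEquivalence _∼_
    resp          : ∀ {a a′ b b′ c c′} → a ∼ a′ → b ∼ b′ → c ∼ c′ → C a b c → C a′ b′ c′
    cyclic        : ∀ {a b c} → C a b c → C b c a
    transitive    : ∀ {a b c d} → C a b c → C a c d → C a b d
    irrefl        : ∀ {a b c} → C a b c → ¬ a ∼ b
    total         : ∀ {a b c} → ¬ a ∼ b → ¬ b ∼ c → ¬ a ∼ c → C a b c ⊎ C a c b

module Gaps (em : ExcludedMiddle 0ℓ) {A : Set} {_∼_ : Rel A 0ℓ} {C : A → A → A → Set}
            (isCircularOrder : IsCircularOrder _∼_ C) where

  open IsCircularOrder isCircularOrder
  open IsEquivalence isEquivalence using (refl; sym; trans)

  irrefl₂₃ : ∀ {a b c} → C a b c → ¬ b ∼ c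
  irrefl₂₃ h = irrefl (cyclic h)

  irrefl₁₃ : ∀ {a b c} → C a b c → ¬ a ∼ c
  irrefl₁₃ h a∼c = irrefl (cyclic (cyclic h)) (sym a∼c)

  drop-first : ∀ {a b c d} → C a b c → C a c d → C b c d
  drop-first abc acd = cyclic (cyclic (transitive (cyclic acd) (cyclic (cyclic abc))))

  module _ {p x q : A} (pxq : C p x q) where

    not-after-start : ∀ {r} → ¬ C p r q → ¬ C x r q
    not-after-start ¬prq xrq =
      ¬prq (cyclic (transitive (cyclic (cyclic pxq)) (cyclic (cyclic xrq))))

    gap≁ : ∀ {r} → ¬ C p r q → ¬ x ∼ r
    gap≁ ¬prq x∼r = ¬prq (resp refl x∼r refl pxq)

    -- Three distinct points have only two orders, and an `r` between `x` and `q` would lie in the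
    -- arc from `p` to `q`.
    beyond-gap : ∀ {r} → ¬ C p r q → ¬ q ∼ r → C x q r
    beyond-gap ¬prq q≁r with total (irrefl₂₃ pxq) q≁r (gap≁ ¬prq)
    ... | inj₁ xqr = xqr
    ... | inj₂ xrq = ⊥-elim (not-after-start ¬prq xrq)

    -- The right-hand side does not mention x: the order seen from x depends only on the gap.
    gap-order : ∀ {r s} → ¬ C p r q → ¬ C p s q → C x r s ⇔ (C q r s ⊎ (q ∼ r × ¬ q ∼ s))
    gap-order {r} {s} ¬prq ¬psq = mk⇔ ⇒ ⇐
      where
      ⇒ : C x r s → C q r s ⊎ (q ∼ r × ¬ q ∼ s)
      ⇒ xrs with em {q ∼ r}
      ... | yes q∼r = inj₂ (q∼r , λ q∼s → irrefl₂₃ xrs (trans (sym q∼r) q∼s))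
      ... | no  q≁r = inj₁ (drop-first (beyond-gap ¬prq q≁r) xrs)

      ⇐ : C q r s ⊎ (q ∼ r × ¬ q ∼ s) → C x r s
      ⇐ (inj₁ qrs) = cyclic (cyclic (drop-first qrs (cyclic (beyond-gap ¬psq (irrefl₁₃ qrs)))))
      ⇐ (inj₂ (q∼r , q≁s)) = resp refl q∼r refl (beyond-gap ¬psq q≁s)

  module _ {J : Set} (pt : J → A) (js : List J) {x : A} (fresh : ∀ {j} → j ∈ js → ¬ x ∼ pt j) where

    -- Endpoints may be any points of `js`, but emptiness is claimed for `rs` only; this permits
    -- induction on `rs`.
    record Gap (rs : List J) : Set where
      field
        {p q} : J
        p∈    : p ∈ js
        q∈    : q ∈ js
        pxq   : C (pt p) x (pt q)
        empty : ∀ {r} → r ∈ rs → ¬ C (pt p) (pt r) (pt q)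

    -- The distinct points `a` and `b` bound two arcs, one of which contains `x`. Each further point
    -- either misses the current arc or cuts it in two, and then the half with `x` is kept.
    gap : ∀ {a b} → a ∈ js → b ∈ js → ¬ pt a ∼ pt b → ∀ {rs} → rs ⊆ js → Gap rs
    gap a∈ b∈ a≁b {[]} _ with total (λ a∼x → fresh a∈ (sym a∼x)) (fresh b∈) a≁b
    ... | inj₁ axb = record { p∈ = a∈ ; q∈ = b∈ ; pxq = axb ; empty = λ () }
    ... | inj₂ abx = record { p∈ = b∈ ; q∈ = a∈ ; pxq = cyclic abx ; empty = λ () }
    gap a∈ b∈ a≁b {r ∷ rs} rs⊆ with gap a∈ b∈ a≁b (rs⊆ ∘ there)
    ... | g with em {C (pt (Gap.p g)) (pt r) (pt (Gap.q g))}
    ...   | no ¬prq = record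
      { p∈ = p∈ ; q∈ = q∈ ; pxq = pxq
      ; empty = λ { (here ≡.refl) → ¬prq ; (there r∈) → empty r∈ } }
      where open Gap g
    ...   | yes prq with total (irrefl prq) (λ r∼x → fresh (rs⊆ (here ≡.refl)) (sym r∼x)) (irrefl (Gap.pxq g))
    ...     | inj₁ prx = record
      { p∈ = rs⊆ (here ≡.refl) ; q∈ = q∈ ; pxq = drop-first prx pxq
      ; empty = λ { (here ≡.refl) h → irrefl h refl ; (there r∈) h → not-after-start prq (empty r∈) h } }
      where open Gap g
    ...     | inj₂ pxr = record
      { p∈ = p∈ ; q∈ = rs⊆ (here ≡.refl) ; pxq = pxr
      ; empty = λ { (here ≡.refl) h → irrefl₂₃ h refl ; (there r∈) h → empty r∈ (transitive h prq) } }
      where open Gap g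

  module _ {J : Set} (pt pt′ : J → A) (js : List J)
           (C⇔ : ∀ {r s t} → r ∈ js → s ∈ js → t ∈ js → C (pt r) (pt s) (pt t) ⇔ C (pt′ r) (pt′ s) (pt′ t))
           (∼⇔ : ∀ {r s} → r ∈ js → s ∈ js → pt r ∼ pt s ⇔ pt′ r ∼ pt′ s) where

    -- By cyclicity, triples with `x` in the first place stand for all triples in which `x` occurs
    -- once.
    SamePosition : A → A → Set
    SamePosition x x′ = (∀ {r} → r ∈ js → ¬ x′ ∼ pt′ r) ×
                        (∀ {r s} → r ∈ js → s ∈ js → C x (pt r) (pt s) ⇔ C x′ (pt′ r) (pt′ s))

    -- `C⇔` carries the emptiness of the gap of `x` over to the image arc. By `gap-order` the order
    -- seen from a point of either arc is a condition on the marked points alone, and `C⇔` and `∼⇔`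
    -- transfer that condition. The result is a whole arc, which leaves room for choosing `x′` by
    -- density.
    samePosition : ∀ {x} → (∀ {j} → j ∈ js → ¬ x ∼ pt j) →
                   ∀ {a b} → a ∈ js → b ∈ js → ¬ pt a ∼ pt b →
                   ∃₂ λ u v → ¬ u ∼ v × (∀ x′ → C u x′ v → SamePosition x x′)
    samePosition {x} fresh a∈ b∈ a≁b with gap pt js fresh a∈ b∈ a≁b id
    ... | g = pt′ p , pt′ q , (λ p∼q → irrefl₁₃ pxq (from (∼⇔ p∈ q∈) p∼q)) ,
              λ x′ p′x′q′ → (λ r∈ → gap≁ p′x′q′ (empty′ r∈)) , λ r∈ s∈ → mk⇔
                (λ xrs → from (gap-order p′x′q′ (empty′ r∈) (empty′ s∈))
                  (Sum.map (to (C⇔ q∈ r∈ s∈)) (λ { (q∼r , q≁s) → to (∼⇔ q∈ r∈) q∼r , λ e → q≁s (from (∼⇔ q∈ s∈) e) })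
                    (to (gap-order pxq (empty r∈) (empty s∈)) xrs)))
                (λ x′rs → from (gap-order pxq (empty r∈) (empty s∈))
                  (Sum.map (from (C⇔ q∈ r∈ s∈)) (λ { (q∼r , q≁s) → from (∼⇔ q∈ r∈) q∼r , λ e → q≁s (to (∼⇔ q∈ s∈) e) })
                    (to (gap-order p′x′q′ (empty′ r∈) (empty′ s∈)) x′rs)))
      where
      open Gap g
      empty′ : ∀ {r} → r ∈ js → ¬ C (pt′ p) (pt′ r) (pt′ q)
      empty′ r∈ h = empty r∈ (from (C⇔ p∈ r∈ q∈) h)

-- The geometry of 𝕊_L

module CircularOrder (em : ExcludedMiddle 0ℓ) (ℝ : RealField) where

  open RealField ℝ renaming (Carrier to R)
  open RealProperties em ℝ
  open RealArithmetic em ℝ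
  open Circles em ℝ

  open Min ≤-totalOrder using (⊓-sel; x⊓y≤x; x⊓y≤y)
  open Max ≤-totalOrder using (⊔-sel; x≤x⊔y; x≤y⊔x)

  rep-inDomain : ∀ L a → InFundamentalDomain L (rep L a)
  rep-inDomain L a = proj₁ (proj₂ (representative L a))

  rep≈[] : ∀ L a → rep L a ≈[ L ] a
  rep≈[] L a = proj₂ (proj₂ (representative L a))

  rep-unique : ∀ L {a x} → InFundamentalDomain L x → x ≈[ L ] a → rep L a ≈ x
  rep-unique L {a} x∈ x≈a =
    domain-unique L (rep-inDomain L a) x∈ (≈[]-trans L (rep≈[] L a) (≈[]-sym L x≈a))

  rep-injective : ∀ L {a b} → rep L a ≈ rep L b → a ≈[ L ] b
  rep-injective L {a} {b} p =
    ≈[]-trans L (≈[]-sym L (rep≈[] L a)) (≈[]-trans L (≈⇒≈[] L p) (rep≈[] L b))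

  module _ (L : Length) where

    C-cyclic : ∀ {a b c} → Circular L a b c → Circular L b c a
    C-cyclic (inj₁ (p , q))        = inj₂ (inj₂ (p , q))
    C-cyclic (inj₂ (inj₁ (p , q))) = inj₁ (p , q)
    C-cyclic (inj₂ (inj₂ (p , q))) = inj₂ (inj₁ (p , q))

    C-trans : ∀ {a b c d} → Circular L a b c → Circular L a c d → Circular L a b d
    C-trans (inj₁ (a<b , b<c)) (inj₁ (a<c , c<d))        = inj₁ (a<b , <-trans b<c c<d)
    C-trans (inj₁ (a<b , b<c)) (inj₂ (inj₁ (c<d , d<a))) =
      ⊥-elim (<-irrefl refl (<-trans a<b (<-trans b<c (<-trans c<d d<a))))
    C-trans (inj₁ (a<b , b<c)) (inj₂ (inj₂ (d<a , a<c))) = inj₂ (inj₂ (d<a , a<b))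
    C-trans (inj₂ (inj₁ (b<c , c<a))) (inj₁ (a<c , c<d)) = ⊥-elim (<-irrefl refl (<-trans a<c c<a))
    C-trans (inj₂ (inj₁ (b<c , c<a))) (inj₂ (inj₁ (c<d , d<a))) = inj₂ (inj₁ (<-trans b<c c<d , d<a))
    C-trans (inj₂ (inj₁ (b<c , c<a))) (inj₂ (inj₂ (d<a , a<c))) = ⊥-elim (<-irrefl refl (<-trans a<c c<a))
    C-trans (inj₂ (inj₂ (c<a , a<b))) (inj₁ (a<c , c<d)) = ⊥-elim (<-irrefl refl (<-trans a<c c<a))
    C-trans (inj₂ (inj₂ (c<a , a<b))) (inj₂ (inj₁ (c<d , d<a))) = inj₂ (inj₂ (d<a , a<b))
    C-trans (inj₂ (inj₂ (c<a , a<b))) (inj₂ (inj₂ (d<a , a<c))) = ⊥-elim (<-irrefl refl (<-trans a<c c<a))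

    C-irrefl : ∀ {a b c} → Circular L a b c → ¬ a ≈[ L ] b
    C-irrefl h a≈b with rep-cong L a≈b
    C-irrefl (inj₁ (a<b , _))          _ | e = <-irrefl e a<b
    C-irrefl (inj₂ (inj₁ (b<c , c<a))) _ | e = <-irrefl (sym e) (<-trans b<c c<a)
    C-irrefl (inj₂ (inj₂ (_ , a<b)))   _ | e = <-irrefl e a<b

    C-total : ∀ {a b c} → ¬ a ≈[ L ] b → ¬ b ≈[ L ] c → ¬ a ≈[ L ] c → Circular L a b c ⊎ Circular L a c b
    C-total {a} {b} {c} a≉b b≉c a≉c
      with compare (rep L a) (rep L b) | compare (rep L b) (rep L c) | compare (rep L a) (rep L c)
    ... | tri≈ _ e _ | _ | _ = ⊥-elim (a≉b (rep-injective L e))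
    ... | tri< _ _ _ | tri≈ _ e _ | _ = ⊥-elim (b≉c (rep-injective L e))
    ... | tri> _ _ _ | tri≈ _ e _ | _ = ⊥-elim (b≉c (rep-injective L e))
    ... | tri< _ _ _ | tri< _ _ _ | tri≈ _ e _ = ⊥-elim (a≉c (rep-injective L e))
    ... | tri< _ _ _ | tri> _ _ _ | tri≈ _ e _ = ⊥-elim (a≉c (rep-injective L e))
    ... | tri> _ _ _ | tri< _ _ _ | tri≈ _ e _ = ⊥-elim (a≉c (rep-injective L e))
    ... | tri> _ _ _ | tri> _ _ _ | tri≈ _ e _ = ⊥-elim (a≉c (rep-injective L e))
    ... | tri< a<b _ _ | tri< b<c _ _ | _ = inj₁ (inj₁ (a<b , b<c))
    ... | tri> _ _ b<a | tri> _ _ c<b | _ = inj₂ (inj₂ (inj₁ (c<b , b<a)))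
    ... | tri< a<b _ _ | tri> _ _ c<b | tri< a<c _ _ = inj₂ (inj₁ (a<c , c<b))
    ... | tri< a<b _ _ | tri> _ _ c<b | tri> _ _ c<a = inj₁ (inj₂ (inj₂ (c<a , a<b)))
    ... | tri> _ _ b<a | tri< b<c _ _ | tri< a<c _ _ = inj₂ (inj₂ (inj₂ (b<a , a<c)))
    ... | tri> _ _ b<a | tri< b<c _ _ | tri> _ _ c<a = inj₁ (inj₂ (inj₁ (b<c , c<a)))

    isCircularOrder : IsCircularOrder (_≈[ L ]_) (Circular L)
    isCircularOrder = record
      { isEquivalence = ≈[]-isEquivalence L
      ; resp          = Circular-resp L
      ; cyclic        = C-cyclic
      ; transitive    = C-trans
      ; irrefl        = C-irrefl
      ; total         = C-total
      }

  -- Distance below `r` in terms of lifts to the line, free of the minimum and the absolute value in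
  -- `d`.
  record Near (L : Length) (r a b : R) : Set where
    constructor near
    field
      {a₀ b₀} : R
      a₀≈a    : a₀ ≈[ L ] a
      b₀≈b    : b₀ ≈[ L ] b
      a₀<b₀+r : a₀ < b₀ + r
      b₀<a₀+r : b₀ < a₀ + r

  -- What the back-and-forth argument needs to know about 𝕊_L besides the
  -- circular order itself.
  record Geometry (L : Length) : Set where
    field
      translate    : ∀ w {a b c} → Circular L a b c → Circular L (a + w) (b + w) (c + w)
      reflect      : ∀ {a b c} → Circular L a b c → Circular L (- c) (- b) (- a)
      C-between    : ∀ {a b} → ¬ a ≈[ L ] b → ∃ λ m → Circular L a m b
      C-open       : ∀ {a x b} → Circular L a x b →
                     ∃ λ ε → 0# < ε × (∀ v → Near L ε x v → Circular L a v b)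
      Near⇒C       : ∀ {x y} → Near L 1# x y → Circular L (y - 1#) x (y + 1#)
      C⇒Near       : ∀ {x y} → Circular L (y - 1#) x (y + 1#) → Near L 1# x y
      d<⇒Near      : ∀ {r x y} → 0# < r → d L x y < r → Near L r x y
      Near⇒d<      : ∀ {r x y} → Near L r x y → d L x y < r
      d≈±          : ∀ x y → d L x y ≈[ L ] x - y ⊎ d L x y ≈[ L ] - (x - y)

  neg-anti-< : ∀ {x y} → x < y → - y < - x
  neg-anti-< p = rearrange-< p (solve 2 (λ x y → (:- y) :+ y := (:- x) :+ x) refl _ _)

  0<y-x : ∀ {x y} → x < y → 0# < y - x
  0<y-x p = rearrange-< p (solve 2 (λ x y → con (+ 0) :+ y := (y :- x) :+ x) refl _ _)

  <⊎≥ : ∀ x y → x < y ⊎ y ≤ x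
  <⊎≥ x y with compare x y
  ... | tri< x<y _ _ = inj₁ x<y
  ... | tri≈ x≮y _ _ = inj₂ (≮⇒≥ x≮y)
  ... | tri> x≮y _ _ = inj₂ (≮⇒≥ x≮y)

  -- The line

  module Line where

    geometry : Geometry ∞
    geometry = record
      { translate = λ w → λ
        { (inj₁ (p , q))        → inj₁ (+-monoˡ-< w p , +-monoˡ-< w q)
        ; (inj₂ (inj₁ (p , q))) → inj₂ (inj₁ (+-monoˡ-< w p , +-monoˡ-< w q))
        ; (inj₂ (inj₂ (p , q))) → inj₂ (inj₂ (+-monoˡ-< w p , +-monoˡ-< w q))
        }
      ; reflect = λ
        { (inj₁ (p , q))        → inj₁ (neg-anti-< q , neg-anti-< p)
        ; (inj₂ (inj₁ (p , q))) → inj₂ (inj₂ (neg-anti-< q , neg-anti-< p))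
        ; (inj₂ (inj₂ (p , q))) → inj₂ (inj₁ (neg-anti-< q , neg-anti-< p))
        }
      ; C-between = C-between
      ; C-open    = C-open
      ; Near⇒C    = λ { {x} {y} (near {a₀} {b₀} p q u v) → inj₁
          ( rearrange-< v (trans (+-cong (+-congʳ (sym q)) (+-congʳ p))
              (solve 3 (λ x b o → (b :- o) :+ (x :+ o) := x :+ b) refl x b₀ 1#))
          , <-respˡ p (<-respʳ (+-congʳ q) u)) }
      ; C⇒Near    = λ
        { (inj₁ (p , q)) → near refl refl q
            (rearrange-< p (solve 3 (λ x y o → y :+ x := (x :+ o) :+ (y :- o)) refl _ _ _))
        ; (inj₂ (inj₁ (p , q))) → ⊥-elim (y+1≮y-1 q)
        ; (inj₂ (inj₂ (p , q))) → ⊥-elim (y+1≮y-1 p)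
        }
      ; d<⇒Near   = λ _ p → near refl refl
          (rearrange-< (proj₁ (∣∣<⇒ p)) (solve 3 (λ x y r → x :+ r := (y :+ r) :+ (x :- y)) refl _ _ _))
          (rearrange-< (proj₂ (∣∣<⇒ p)) (solve 3 (λ x y r → y :+ r := (x :+ r) :+ (:- (x :- y))) refl _ _ _))
      ; Near⇒d<   = λ { (near p q u v) → ∣∣<⇐
          (rearrange-< (<-respˡ p (<-respʳ (+-congʳ q) u)) (solve 3 (λ x y r → (x :- y) :+ (y :+ r) := r :+ x) refl _ _ _))
          (rearrange-< (<-respˡ q (<-respʳ (+-congʳ p) v)) (solve 3 (λ x y r → (:- (x :- y)) :+ (x :+ r) := r :+ y) refl _ _ _)) }
      ; d≈±       = λ x y → ⊔-sel (x - y) (- (x - y))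
      }
      where
      y+1≮y-1 : ∀ {y} → ¬ (y + 1# < y - 1#)
      y+1≮y-1 p = <-irrefl refl (<-trans 0<2
        (rearrange-< p (solve 2 (λ y o → (o :+ o) :+ (y :- o) := con (+ 0) :+ (y :+ o)) refl _ _)))

      C-between : ∀ {a b} → ¬ a ≈ b → ∃ λ m → Circular ∞ a m b
      C-between {a} {b} a≉b with compare a b
      ... | tri< a<b _ _ = proj₁ (between a<b) , inj₁ (proj₂ (between a<b))
      ... | tri≈ _ a≈b _ = ⊥-elim (a≉b a≈b)
      -- The arc from `a` to `b` now passes through infinity, and any point above `a` lies on it.
      ... | tri> _ _ b<a = a + 1# , inj₂ (inj₂ (b<a , x<x+y a 0<1))

      above : ∀ {a x ε v} → ε ≤ x - a → Near ∞ ε x v → a < v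
      above ε≤ (near p q u v) = rearrange-<
        (+-mono-<-≤ (<-respˡ p (<-respʳ (+-congʳ q) u)) ε≤)
        (solve 4 (λ a x ε v → a :+ ((v :+ ε) :+ (x :- a)) := v :+ (x :+ ε)) refl _ _ _ _)

      below : ∀ {b x ε v} → ε ≤ b - x → Near ∞ ε x v → v < b
      below ε≤ (near p q u v) = rearrange-<
        (+-mono-<-≤ (<-respˡ q (<-respʳ (+-congʳ p) v)) ε≤)
        (solve 4 (λ b x ε v → v :+ ((x :+ ε) :+ (b :- x)) := b :+ (v :+ ε)) refl _ _ _ _)

      C-open : ∀ {a x b} → Circular ∞ a x b →
               ∃ λ ε → 0# < ε × (∀ v → Near ∞ ε x v → Circular ∞ a v b)
      C-open (inj₁ (p , q)) with common-bound (0<y-x p) (0<y-x q)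
      ... | ε , 0<ε , ε≤ , ε≤′ = ε , 0<ε , λ v n → inj₁ (above ε≤ n , below ε≤′ n)
      -- On an arc through infinity, `x` lies on one of two rays, and only the end of that ray
      -- constrains `v`.
      C-open (inj₂ (inj₁ (p , q))) = _ , 0<y-x p , λ v n → inj₂ (inj₁ (below ≤-refl n , q))
      C-open (inj₂ (inj₂ (p , q))) = _ , 0<y-x q , λ v n → inj₂ (inj₂ (p , above ≤-refl n))

  -- Circles of finite length

  module Circle (ℓ : R) (2<ℓ : 1# + 1# < ℓ) where

    private
      L : Length
      L = finite ℓ 2<ℓ

      infix 4 _∼_
      _∼_ : R → R → Set
      _∼_ = _≈[ L ]_

      ∼-trans : ∀ {x y z} → x ∼ y → y ∼ z → x ∼ z
      ∼-trans = ≈[]-trans L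

      ∼-sym : ∀ {x y} → x ∼ y → y ∼ x
      ∼-sym = ≈[]-sym L

    0<ℓ : 0# < ℓ
    0<ℓ = <-trans 0<2 2<ℓ

    +ℓ∼ : ∀ x → x + ℓ ∼ x
    +ℓ∼ x = + 1 , +-congˡ (sym (+-identityʳ ℓ))

    -ℓ∼ : ∀ x → x - ℓ ∼ x
    -ℓ∼ x = -[1+ 0 ] , +-congˡ (-‿cong (sym (+-identityʳ ℓ)))

    x<y+ℓ : ∀ {x y} → 0# ≤ y → x < ℓ → x < y + ℓ
    x<y+ℓ 0≤y x<ℓ = rearrange-< (+-mono-<-≤ x<ℓ 0≤y)
      (solve 3 (λ x y ℓ → x :+ (ℓ :+ y) := (y :+ ℓ) :+ (x :+ con (+ 0))) refl _ _ _)

    -- The circular order read off from lifts to the line, which makes its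
    -- invariance under translations and reflections visible.
    record Lift (a b c : R) : Set where
      constructor lift
      field
        {a₀ b₀ c₀} : R
        a₀∼a       : a₀ ∼ a
        b₀∼b       : b₀ ∼ b
        c₀∼c       : c₀ ∼ c
        a₀<b₀      : a₀ < b₀
        b₀<c₀      : b₀ < c₀
        c₀<a₀+ℓ    : c₀ < a₀ + ℓ

    rep∼ : ∀ a → rep L a ∼ a
    rep∼ = rep≈[] L

    C⇒Lift : ∀ {a b c} → Circular L a b c → Lift a b c
    C⇒Lift {a} {b} {c} (inj₁ (p , q)) =
      lift (rep∼ a) (rep∼ b) (rep∼ c) p q
        (x<y+ℓ (proj₁ (rep-inDomain L a)) (proj₂ (rep-inDomain L c)))
    -- Points whose representatives lie below that of `a` are raised by one turn.
    C⇒Lift {a} {b} {c} (inj₂ (inj₁ (p , q))) =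
      lift (rep∼ a) (∼-trans (+ℓ∼ _) (rep∼ b)) (∼-trans (+ℓ∼ _) (rep∼ c))
        (x<y+ℓ (proj₁ (rep-inDomain L b)) (proj₂ (rep-inDomain L a))) (+-monoˡ-< ℓ p) (+-monoˡ-< ℓ q)
    C⇒Lift {a} {b} {c} (inj₂ (inj₂ (p , q))) =
      lift (rep∼ a) (rep∼ b) (∼-trans (+ℓ∼ _) (rep∼ c))
        q (x<y+ℓ (proj₁ (rep-inDomain L c)) (proj₂ (rep-inDomain L b))) (+-monoˡ-< ℓ p)

    rep-below : ∀ {x u} → 0# ≤ u → u < ℓ → u ∼ x → rep L x ≈ u
    rep-below 0≤u u<ℓ = rep-unique L (0≤u , u<ℓ)

    rep-above : ∀ {x u} → ℓ ≤ u → u < ℓ + ℓ → u ∼ x → rep L x ≈ u - ℓ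
    rep-above ℓ≤u u<2ℓ u∼x = rep-unique L
      ( rearrange-≤ ℓ≤u (solve 2 (λ ℓ u → con (+ 0) :+ u := (u :- ℓ) :+ ℓ) refl _ _)
      , rearrange-< u<2ℓ (solve 2 (λ ℓ u → (u :- ℓ) :+ (ℓ :+ ℓ) := ℓ :+ u) refl _ _))
      (∼-trans (-ℓ∼ _) u∼x)

    -- Both `u` and `v` lie between 0 and 2ℓ, so each representative is the lift itself or the lift
    -- minus ℓ. How many of the two reach ℓ decides which alternative of `Circular` holds.
    normalised⇒C : ∀ {a b c u v} → u ∼ b → v ∼ c → rep L a < u → u < v → v < rep L a + ℓ → Circular L a b c
    normalised⇒C {a} {b} {c} {u} {v} u∼b v∼c x<u u<v v<x+ℓ = cases (<⊎≥ v ℓ) (<⊎≥ u ℓ)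
      where
      x : R
      x = rep L a

      0≤u : 0# ≤ u
      0≤u = <⇒≤ (≤-<-trans (proj₁ (rep-inDomain L a)) x<u)

      0≤v : 0# ≤ v
      0≤v = <⇒≤ (≤-<-trans 0≤u u<v)

      v<2ℓ : v < ℓ + ℓ
      v<2ℓ = <-trans v<x+ℓ (+-monoˡ-< ℓ (proj₂ (rep-inDomain L a)))

      v-ℓ<x : v - ℓ < x
      v-ℓ<x = x<y+z⇒x-z<y v<x+ℓ

      cases : v < ℓ ⊎ ℓ ≤ v → u < ℓ ⊎ ℓ ≤ u → Circular L a b c
      cases (inj₁ v<ℓ) _ = inj₁ (<-respʳ (sym b≈) x<u , <-respˡ (sym b≈) (<-respʳ (sym c≈) u<v))
        where
        b≈ : rep L b ≈ u
        b≈ = rep-below 0≤u (<-trans u<v v<ℓ) u∼b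

        c≈ : rep L c ≈ v
        c≈ = rep-below 0≤v v<ℓ v∼c
      cases (inj₂ ℓ≤v) (inj₁ u<ℓ) =
        inj₂ (inj₂ (<-respˡ (sym (rep-above ℓ≤v v<2ℓ v∼c)) v-ℓ<x , <-respʳ (sym (rep-below 0≤u u<ℓ u∼b)) x<u))
      cases (inj₂ ℓ≤v) (inj₂ ℓ≤u) = inj₂ (inj₁
        ( <-respˡ (sym (rep-above ℓ≤u (<-trans u<v v<2ℓ) u∼b)) (<-respʳ (sym c≈) (+-monoˡ-< (- ℓ) u<v))
        , <-respˡ (sym c≈) v-ℓ<x))
        where
        c≈ : rep L c ≈ v - ℓ
        c≈ = rep-above ℓ≤v v<2ℓ v∼c

    Lift⇒C : ∀ {a b c} → Lift a b c → Circular L a b c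
    Lift⇒C {a} (lift {a₀} {b₀} {c₀} a₀∼a b₀∼b c₀∼c p q r) =
      -- Shifting all three lifts by the same `n` turns brings the first onto the representative of
      -- `a`.
      let n , x≈ = ∼-trans (rep∼ a) (∼-sym a₀∼a) in
      normalised⇒C (∼-trans (n , refl) b₀∼b) (∼-trans (n , refl) c₀∼c)
      (<-respˡ (sym x≈) (+-monoˡ-< (n · ℓ) p))
      (+-monoˡ-< (n · ℓ) q)
      (<-respʳ (trans (solve 3 (λ a ℓ w → (a :+ ℓ) :+ w := (a :+ w) :+ ℓ) refl _ _ _) (+-congʳ (sym x≈)))
        (+-monoˡ-< (n · ℓ) r))

    translate : ∀ w {a b c} → Circular L a b c → Circular L (a + w) (b + w) (c + w)
    translate w h =
      let lift a₀∼a b₀∼b c₀∼c p q r = C⇒Lift h in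
      Lift⇒C (lift (shift a₀∼a) (shift b₀∼b) (shift c₀∼c)
      (+-monoˡ-< w p) (+-monoˡ-< w q)
      (<-respʳ (solve 3 (λ a ℓ w → (a :+ ℓ) :+ w := (a :+ w) :+ ℓ) refl _ _ _) (+-monoˡ-< w r)))
      where
      shift : ∀ {x y} → x ∼ y → x + w ∼ y + w
      shift p = +-cong-[] L p (≈⇒≈[] L refl)

    reflect : ∀ {a b c} → Circular L a b c → Circular L (- c) (- b) (- a)
    reflect h =
      let lift a₀∼a b₀∼b c₀∼c p q r = C⇒Lift h in
      Lift⇒C (lift (-‿cong-[] L c₀∼c) (-‿cong-[] L b₀∼b) (-‿cong-[] L a₀∼a)
      (neg-anti-< q) (neg-anti-< p)
      (rearrange-< r (solve 3 (λ a c ℓ → (:- a) :+ (a :+ ℓ) := (:- c :+ ℓ) :+ c) refl _ _ _)))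

    C-between : ∀ {a b} → ¬ a ∼ b → ∃ λ m → Circular L a m b
    C-between {a} {b} a≁b = cases (compare (rep L a) (rep L b))
      where
      cases : Tri (rep L a < rep L b) (rep L a ≈ rep L b) (rep L b < rep L a) → ∃ λ m → Circular L a m b
      cases (tri≈ _ e _) = ⊥-elim (a≁b (rep-injective L e))
      cases (tri< x<y _ _) =
        let m , x<m , m<y = between x<y in
        m , Lift⇒C (lift (rep∼ a) (≈⇒≈[] L refl) (rep∼ b) x<m m<y
          (x<y+ℓ (proj₁ (rep-inDomain L a)) (proj₂ (rep-inDomain L b))))
      cases (tri> _ _ y<x) =
        let m , x<m , m<y+ℓ = between (x<y+ℓ (proj₁ (rep-inDomain L b)) (proj₂ (rep-inDomain L a))) in
        m , Lift⇒C (lift (rep∼ a) (≈⇒≈[] L refl) (∼-trans (+ℓ∼ _) (rep∼ b)) x<m m<y+ℓ (+-monoˡ-< ℓ y<x))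

    C-open : ∀ {a x b} → Circular L a x b → ∃ λ ε → 0# < ε × (∀ v → Near L ε x v → Circular L a v b)
    C-open {a} {x} {b} h =
      let lift a₀∼a x₀∼x b₀∼b p q r = C⇒Lift h
          ε , 0<ε , ε≤ , ε≤′        = common-bound (0<y-x p) (0<y-x q)
      in ε , 0<ε , λ { v (near {x₁} {v₁} x₁∼x v₁∼v x₁< v₁<) →
        -- The two lifts of `x` may differ by `n` turns; taking these off the lift of `v` puts it
        -- beside `x₀`.
        let n , x₁≈ = ∼-trans x₁∼x (∼-sym x₀∼x) in
        Lift⇒C (lift {b₀ = v₁ - n · ℓ} a₀∼a
          (∼-trans (∼-sym (n , sym (x-y+y≈x v₁ (n · ℓ)))) v₁∼v) b₀∼b
          (rearrange-< (+-mono-<-≤ (<-respˡ x₁≈ x₁<) ε≤)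
            (solve 5 (λ a x v w ε → a :+ ((v :+ ε) :+ (x :- a)) := (v :- w) :+ ((x :+ w) :+ ε)) refl _ _ _ _ _))
          (rearrange-< (+-mono-<-≤ (<-respʳ (+-congʳ x₁≈) v₁<) ε≤′)
            (solve 5 (λ b x v w ε → (v :- w) :+ (((x :+ w) :+ ε) :+ (b :- x)) := b :+ (v :+ ε)) refl _ _ _ _ _))
          r) }

    -- Because ℓ > 2, the arc from `y − 1` to `y + 1` ends before it returns to its start.
    y+1<y-1+ℓ : ∀ {y} → y + 1# < y - 1# + ℓ
    y+1<y-1+ℓ = rearrange-< 2<ℓ (solve 3 (λ y o ℓ → (y :+ o) :+ ℓ := (y :- o :+ ℓ) :+ (o :+ o)) refl _ _ _)

    ∼-+ʳ : ∀ {x y} w → x ∼ y → x + w ∼ y + w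
    ∼-+ʳ w p = +-cong-[] L p (≈⇒≈[] L refl)

    Near⇒C : ∀ {x y} → Near L 1# x y → Circular L (y - 1#) x (y + 1#)
    Near⇒C (near {x₀} {y₀} x₀∼x y₀∼y x₀< y₀<) =
      Lift⇒C (lift (∼-+ʳ (- 1#) y₀∼y) x₀∼x (∼-+ʳ 1# y₀∼y) (x<y+z⇒x-z<y y₀<) x₀< y+1<y-1+ℓ)

    -- Subtracting `a` moves both points into the fundamental domain, where congruent points are
    -- equal.
    lift-unique : ∀ {a u v} → a < u → u < a + ℓ → a < v → v < a + ℓ → u ∼ v → u ≈ v
    lift-unique {a} {u} {v} a<u u< a<v v< u∼v =
      trans (sym (x-y+y≈x u a)) (trans (+-congʳ (domain-unique L (inDomain a<u u<) (inDomain a<v v<) (∼-+ʳ (- a) u∼v)))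
        (x-y+y≈x v a))
      where
      inDomain : ∀ {w} → a < w → w < a + ℓ → InFundamentalDomain L (w - a)
      inDomain p q = <⇒≤ (0<y-x p) , x<y+z⇒x-z<y (<-respʳ (+-comm _ _) q)

    C⇒Near : ∀ {x y} → Circular L (y - 1#) x (y + 1#) → Near L 1# x y
    C⇒Near {x} {y} h = fromLift (C⇒Lift h)
      where
      fromLift : Lift (y - 1#) x (y + 1#) → Near L 1# x y
      fromLift (lift {a₀} {x₀} {c₀} a₀∼ x₀∼x c₀∼ p q r) =
        near {b₀ = a₀ + 1#} x₀∼x y∼ (<-respʳ c₀≈ q) (+-monoˡ-< 1# p)
        where
        y∼ : a₀ + 1# ∼ y
        y∼ = ∼-trans (∼-+ʳ 1# a₀∼) (≈⇒≈[] L (x-y+y≈x y 1#))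

        -- `Lift` determines `c₀` only modulo ℓ. Both sides lie within one turn above `a₀`, the
        -- right-hand one because 2 < ℓ.
        c₀≈ : c₀ ≈ a₀ + 1# + 1#
        c₀≈ = lift-unique (<-trans p q) r
          (<-trans (x<x+y a₀ 0<1) (x<x+y _ 0<1))
          (rearrange-< 2<ℓ (solve 3 (λ a o ℓ → (a :+ o :+ o) :+ ℓ := (a :+ ℓ) :+ (o :+ o)) refl _ _ _))
          (∼-trans c₀∼ (∼-+ʳ 1# (∼-sym y∼)))

    d<⇒Near : ∀ {r x y} → 0# < r → d L x y < r → Near L r x y
    d<⇒Near {r} {x} {y} 0<r d<r = cases (⊓<⇒<⊎< d<r) (⊔-sel (X - Y) (- (X - Y)))
      where
      X Y : R
      X = rep L x
      Y = rep L y

      cases : ∣ X - Y ∣ < r ⊎ ℓ - ∣ X - Y ∣ < r → ∣ X - Y ∣ ≈ X - Y ⊎ ∣ X - Y ∣ ≈ - (X - Y) → Near L r x y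
      cases (inj₁ e<r) _ = near (rep∼ x) (rep∼ y)
        (rearrange-< (proj₁ (∣∣<⇒ e<r)) (solve 3 (λ x y r → x :+ r := (y :+ r) :+ (x :- y)) refl X Y r))
        (rearrange-< (proj₂ (∣∣<⇒ e<r)) (solve 3 (λ x y r → y :+ r := (x :+ r) :+ (:- (x :- y))) refl X Y r))
      -- The short way leads through 0, so the smaller representative is raised by one turn.
      cases (inj₂ ℓ-e<r) (inj₁ e) = near (rep∼ x) (∼-trans (+ℓ∼ _) (rep∼ y))
        (<-trans (x<y+ℓ (proj₁ (rep-inDomain L y)) (proj₂ (rep-inDomain L x))) (x<x+y _ 0<r))
        (rearrange-< (<-respˡ (+-congˡ (-‿cong e)) ℓ-e<r)
          (solve 4 (λ x y r ℓ → (y :+ ℓ) :+ r := (x :+ r) :+ (ℓ :- (x :- y))) refl X Y r ℓ))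
      cases (inj₂ ℓ-e<r) (inj₂ e) = near (∼-trans (+ℓ∼ _) (rep∼ x)) (rep∼ y)
        (rearrange-< (<-respˡ (+-congˡ (-‿cong e)) ℓ-e<r)
          (solve 4 (λ x y r ℓ → (x :+ ℓ) :+ r := (y :+ r) :+ (ℓ :- (:- (x :- y)))) refl X Y r ℓ))
        (<-trans (x<y+ℓ (proj₁ (rep-inDomain L x)) (proj₂ (rep-inDomain L y))) (x<x+y _ 0<r))

    Near⇒d< : ∀ {r x y} → Near L r x y → d L x y < r
    Near⇒d< {r} {x} {y} (near x₀∼x y₀∼y x₀< y₀<) =
      let m , x₀≈ = ∼-trans x₀∼x (∼-sym (rep∼ x))
          n , y₀≈ = ∼-trans y₀∼y (∼-sym (rep∼ y))
          m-n     = trans (·-homo-+ ℓ m (ℤ.- n)) (+-congˡ (·-neg ℓ n))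
      in close (m ℤ.- n)
        (rearrange-< (<-respˡ x₀≈ (<-respʳ (+-congʳ y₀≈) x₀<)) (trans (+-congʳ (+-congˡ m-n))
          (solve 5 (λ X Y u v r → (X :+ (u :- v)) :+ ((Y :+ v) :+ r) := (Y :+ r) :+ (X :+ u))
            refl X Y (m · ℓ) (n · ℓ) r)))
        (rearrange-< (<-respˡ y₀≈ (<-respʳ (+-congʳ x₀≈) y₀<)) (trans
          (solve 5 (λ X Y u v r → Y :+ ((X :+ u) :+ r) := ((X :+ (u :- v)) :+ r) :+ (Y :+ v))
            refl X Y (m · ℓ) (n · ℓ) r)
          (+-congʳ (+-congʳ (+-congˡ (sym m-n))))))
      where
      X Y : R
      X = rep L x
      Y = rep L y

      far : ∀ {e} → e ≤ ∣ X - Y ∣ → ℓ - e < r → d L x y < r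
      far e≤ p = ≤-<-trans (x⊓y≤y _ _)
        (≤-<-trans (rearrange-≤ e≤ (solve 3 (λ e f ℓ → (ℓ :- f) :+ f := (ℓ :- e) :+ e) refl _ ∣ X - Y ∣ ℓ)) p)

      close : ∀ k → X + k · ℓ < Y + r → Y < X + k · ℓ + r → d L x y < r
      close (+ ℕ.zero) p q = ≤-<-trans (x⊓y≤x _ _) (∣∣<⇐
        (rearrange-< p (solve 3 (λ x y r → (x :- y) :+ (y :+ r) := r :+ (x :+ con (+ 0))) refl X Y r))
        (rearrange-< q (solve 3 (λ x y r → (:- (x :- y)) :+ (x :+ con (+ 0) :+ r) := r :+ y) refl X Y r)))
      close (+ ℕ.suc j) p q = far (x≤y⊔x (X - Y) (- (X - Y)))
        (rearrange-< (+-mono-<-≤ p (0≤×ₙ 0<ℓ j))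
          (solve 5 (λ x y r ℓ s → (ℓ :- (:- (x :- y))) :+ (y :+ r :+ s) := r :+ (x :+ (ℓ :+ s) :+ con (+ 0)))
            refl X Y r ℓ (j ×ₙ ℓ)))
      close -[1+ j ] p q = far (x≤x⊔y (X - Y) (- (X - Y)))
        (rearrange-< (+-mono-<-≤ q (0≤×ₙ 0<ℓ j))
          (solve 5 (λ x y r ℓ s → (ℓ :- (x :- y)) :+ (x :+ (:- (ℓ :+ s)) :+ r :+ s) := r :+ (y :+ con (+ 0)))
            refl X Y r ℓ (j ×ₙ ℓ)))

    -- Modulo ℓ, `ℓ − e` is `− e`, so the minimum and the absolute value merely choose a sign.
    d≈± : ∀ x y → d L x y ∼ x - y ⊎ d L x y ∼ - (x - y)
    d≈± x y = cases (⊓-sel ∣ X - Y ∣ (ℓ - ∣ X - Y ∣)) (⊔-sel (X - Y) (- (X - Y)))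
      where
      X Y : R
      X = rep L x
      Y = rep L y

      e∼ : X - Y ∼ x - y
      e∼ = +-cong-[] L (rep∼ x) (-‿cong-[] L (rep∼ y))

      cases : d L x y ≈ ∣ X - Y ∣ ⊎ d L x y ≈ ℓ - ∣ X - Y ∣ →
              ∣ X - Y ∣ ≈ X - Y ⊎ ∣ X - Y ∣ ≈ - (X - Y) → d L x y ∼ x - y ⊎ d L x y ∼ - (x - y)
      cases (inj₁ p) (inj₁ q) = inj₁ (∼-trans (≈⇒≈[] L (trans p q)) e∼)
      cases (inj₁ p) (inj₂ q) = inj₂ (∼-trans (≈⇒≈[] L (trans p q)) (-‿cong-[] L e∼))
      cases (inj₂ p) (inj₁ q) = inj₂ (∼-trans (≈⇒≈[] L (trans p (trans (+-congˡ (-‿cong q)) (+-comm _ _))))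
        (∼-trans (+ℓ∼ _) (-‿cong-[] L e∼)))
      cases (inj₂ p) (inj₂ q) = inj₁ (∼-trans (≈⇒≈[] L (trans p (trans (+-congˡ (-‿cong q))
        (solve 2 (λ e ℓ → ℓ :- (:- e) := e :+ ℓ) refl (X - Y) ℓ)))) (∼-trans (+ℓ∼ _) e∼))

    geometry : Geometry L
    geometry = record
      { translate = translate ; reflect = reflect ; C-between = C-between ; C-open = C-open
      ; Near⇒C = Near⇒C ; C⇒Near = C⇒Near ; d<⇒Near = d<⇒Near ; Near⇒d< = Near⇒d< ; d≈± = d≈± }

  geometry : ∀ L → Geometry L
  geometry (finite ℓ 2<ℓ) = Circle.geometry ℓ 2<ℓ
  geometry ∞              = Line.geometry

-- Extending tuples of vertices

embed : ∀ {n} → Formula ℒG n → Formula ℒGC n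
embed ⊥̇          = ⊥̇
embed (i ≐ j)    = i ≐ j
embed (rel E is) = rel E is
embed (φ ⇒̇ ψ)    = embed φ ⇒̇ embed ψ
embed (φ ∧̇ ψ)    = embed φ ∧̇ embed ψ
embed (φ ∨̇ ψ)    = embed φ ∨̇ embed ψ
embed (∀̇ φ)      = ∀̇ embed φ
embed (∃̇ φ)      = ∃̇ embed φ

module _ (em : ExcludedMiddle 0ℓ) (ℝ : RealField) where
  open Circles em ℝ

  embed-⊨ : ∀ L S G {n} (φ : Formula ℒG n) {ρ} →
            structureGC L S G ⊨ embed φ [ ρ ] ⇔ structureG G ⊨ φ [ ρ ]
  embed-⊨ L S G ⊥̇       = mk⇔ id id
  embed-⊨ L S G (i ≐ j) = mk⇔ id id
  embed-⊨ L S G (rel E (i ∷ j ∷ [])) = mk⇔ id id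
  embed-⊨ L S G (φ ⇒̇ ψ) = mk⇔
    (λ h → to (embed-⊨ L S G ψ) ∘ h ∘ from (embed-⊨ L S G φ))
    (λ h → from (embed-⊨ L S G ψ) ∘ h ∘ to (embed-⊨ L S G φ))
  embed-⊨ L S G (φ ∧̇ ψ) = mk⇔
    (λ { (p , q) → to (embed-⊨ L S G φ) p , to (embed-⊨ L S G ψ) q })
    (λ { (p , q) → from (embed-⊨ L S G φ) p , from (embed-⊨ L S G ψ) q })
  embed-⊨ L S G (φ ∨̇ ψ) = mk⇔
    (λ { (inj₁ p) → inj₁ (to (embed-⊨ L S G φ) p) ; (inj₂ q) → inj₂ (to (embed-⊨ L S G ψ) q) })
    (λ { (inj₁ p) → inj₁ (from (embed-⊨ L S G φ) p) ; (inj₂ q) → inj₂ (from (embed-⊨ L S G ψ) q) })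
  embed-⊨ L S G (∀̇ φ) = mk⇔ (λ h x → to (embed-⊨ L S G φ) (h x)) (λ h x → from (embed-⊨ L S G φ) (h x))
  embed-⊨ L S G (∃̇ φ) = mk⇔
    (λ { (x , h) → x , to (embed-⊨ L S G φ) h }) (λ { (x , h) → x , from (embed-⊨ L S G φ) h })

-- Finite sets of shifts

shifts : List SymGC → List ℤ
shifts = concatMap λ { E → [] ; (C z t k) → z ∷ t ∷ k ∷ [] }

-- These are the shifts of old vertices that `recentre₁` and `recentre₂` produce.
differences : List ℤ → List ℤ
differences Z = cartesianProductWith ℤ._-_ Z Z

-- The shifts ±1 are the endpoints of the unit ball around a vertex.
window : List ℤ → List ℤ
window Z = + 1 ∷ + 0 ∷ -[1+ 0 ] ∷ differences Z

circulars : List ℤ → List SymGC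
circulars W = cartesianProductWith (λ { z (t , k) → C z t k }) W (cartesianProduct W W)

refine : List SymGC → List SymGC
refine Σ = Σ ++ circulars (window (shifts Σ))

∈-circulars : ∀ {W z t k} → z ∈ W → t ∈ W → k ∈ W → C z t k ∈ circulars W
∈-circulars z∈ t∈ k∈ = ∈-cartesianProductWith⁺ _ z∈ (∈-cartesianProduct⁺ t∈ k∈)

∈-shifts : ∀ {Σ z t k s} → C z t k ∈ Σ → s ∈ z ∷ t ∷ k ∷ [] → s ∈ shifts Σ
∈-shifts C∈ s∈ = ∈-concatMap⁺ _ (lose C∈ s∈)

-- The back-and-forth step

module Extension (em : ExcludedMiddle 0ℓ) (ℝ : RealField) (L : Circles.Length em ℝ) where

  open RealField ℝ renaming (Carrier to R)
  open RealProperties em ℝ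
  open RealArithmetic em ℝ
  open Circles em ℝ
  open CircularOrder em ℝ
  open Geometry (geometry L)
  open Gaps em (isCircularOrder L)

  infix 4 _∼_
  _∼_ : R → R → Set
  _∼_ = _≈[ L ]_

  ∼-refl : ∀ {x} → x ∼ x
  ∼-refl = ≈⇒≈[] L refl

  cyclic² : ∀ {a b c} → Circular L a b c → Circular L c a b
  cyclic² = C-cyclic L ∘ C-cyclic L

  translate-to : ∀ w {a b c a′ b′ c′} → a + w ≈ a′ → b + w ≈ b′ → c + w ≈ c′ →
                 Circular L a b c → Circular L a′ b′ c′
  translate-to w p q r h = Circular-resp L (≈⇒≈[] L p) (≈⇒≈[] L q) (≈⇒≈[] L r) (translate w h)

  reflect-to : ∀ w {a b c a′ b′ c′} → - a + w ≈ a′ → - b + w ≈ b′ → - c + w ≈ c′ →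
               Circular L a b c → Circular L c′ b′ a′
  reflect-to w p q r h = translate-to w r q p (reflect h)

  recentre₁ : ∀ {x u v} z t k → Circular L (x + fromℤ z) (u + fromℤ t) (v + fromℤ k) ⇔
                                Circular L x (u + fromℤ (t ℤ.- z)) (v + fromℤ (k ℤ.- z))
  recentre₁ {x} {u} {v} z t k = mk⇔
    (translate-to (- fromℤ z) (x+y-y≈x x _) (shift t) (shift k))
    (translate-to (fromℤ z) refl (unshift t) (unshift k))
    where
    shift : ∀ {u} t → u + fromℤ t - fromℤ z ≈ u + fromℤ (t ℤ.- z)
    shift t = trans (+-assoc _ _ _) (+-congˡ (sym (fromℤ-homo-- t z)))

    unshift : ∀ {u} t → u + fromℤ (t ℤ.- z) + fromℤ z ≈ u + fromℤ t
    unshift t = trans (+-congʳ (sym (shift t))) (x-y+y≈x _ _)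

  -- No translation frees two shifted copies of `x` at once. The reflection `a ↦ x + u + k − a`
  -- does: it takes both to shifts of `u`, and `u + k` to `x`.
  recentre₂ : ∀ {x u} z t k → Circular L (x + fromℤ z) (x + fromℤ t) (u + fromℤ k) ⇔
                              Circular L x (u + fromℤ (k ℤ.- t)) (u + fromℤ (k ℤ.- z))
  recentre₂ {x} {u} z t k = mk⇔
    (reflect-to w (flip z) (flip t) (solve 3 (λ x u k → (:- (u :+ k)) :+ (x :+ u :+ k) := x) refl x u (fromℤ k)))
    (reflect-to w (solve 3 (λ x u k → (:- x) :+ (x :+ u :+ k) := u :+ k) refl x u (fromℤ k)) (unflip t) (unflip z))
    where
    w : R
    w = x + u + fromℤ k

    flip : ∀ z → - (x + fromℤ z) + w ≈ u + fromℤ (k ℤ.- z)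
    flip z = trans (solve 4 (λ x u k z → (:- (x :+ z)) :+ (x :+ u :+ k) := u :+ (k :- z)) refl x u (fromℤ k) (fromℤ z))
      (+-congˡ (sym (fromℤ-homo-- k z)))

    unflip : ∀ z → - (u + fromℤ (k ℤ.- z)) + w ≈ x + fromℤ z
    unflip z = trans (+-congʳ (-‿cong (+-congˡ (fromℤ-homo-- k z))))
      (solve 4 (λ x u k z → (:- (u :+ (k :- z))) :+ (x :+ u :+ k) := x :+ z) refl x u (fromℤ k) (fromℤ z))

  Near⇔C : ∀ {x y} → Near L 1# x y ⇔ Circular L x (y + fromℤ (+ 1)) (y + fromℤ -[1+ 0 ])
  Near⇔C {x} {y} = mk⇔
    (λ n → Circular-resp L ∼-refl (≈⇒≈[] L (sym +1≈)) (≈⇒≈[] L (sym -1≈)) (C-cyclic L (Near⇒C n)))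
    (λ h → C⇒Near (cyclic² (Circular-resp L ∼-refl (≈⇒≈[] L +1≈) (≈⇒≈[] L -1≈) h)))
    where
    +1≈ : y + fromℤ (+ 1) ≈ y + 1#
    +1≈ = +-congˡ (+-identityʳ 1#)

    -1≈ : y + fromℤ -[1+ 0 ] ≈ y - 1#
    -1≈ = +-congˡ (-‿cong (+-identityʳ 1#))

  Near-refl : ∀ y → Near L 1# y y
  Near-refl y = near ∼-refl ∼-refl (x<x+y y 0<1) (x<x+y y 0<1)

  d<1⇔Near : ∀ {x y} → d L x y < 1# ⇔ Near L 1# x y
  d<1⇔Near = mk⇔ (d<⇒Near 0<1) Near⇒d<

  -- Otherwise `x − y` would be congruent to an integer, and so would the distance of these distinct
  -- vertices, which is `x − y` up to sign modulo L.
  free⇒∼ : ∀ S → IntegerDistanceFree L S → ∀ (u v : Point S) z t →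
           proj₁ u + fromℤ z ∼ proj₁ v + fromℤ t → proj₁ u ∼ proj₁ v
  free⇒∼ S free u v z t p = decide em
    where
    x y : R
    x = proj₁ u
    y = proj₁ v

    x-y∼ : x - y ∼ fromℤ (t ℤ.- z)
    x-y∼ = ≈[]-trans L (≈⇒≈[] L (solve 3 (λ x y z → x :- y := (x :+ z) :+ (:- y :- z)) refl x y (fromℤ z)))
      (≈[]-trans L (+-cong-[] L p ∼-refl)
        (≈⇒≈[] L (trans (solve 3 (λ y z t → (y :+ t) :+ (:- y :- z) := t :- z) refl y (fromℤ z) (fromℤ t))
          (sym (fromℤ-homo-- t z)))))

    absurd : ¬ (x ∼ y) → d L x y ∼ x - y ⊎ d L x y ∼ - (x - y) → x ∼ y
    absurd x≁y (inj₁ q) = ⊥-elim (free (u , v , t ℤ.- z , x≁y , ≈[]-trans L q x-y∼))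
    absurd x≁y (inj₂ q) = ⊥-elim (free (u , v , ℤ.- (t ℤ.- z) , x≁y ,
      ≈[]-trans L q (≈[]-trans L (-‿cong-[] L x-y∼) (≈⇒≈[] L (sym (·-neg 1# (t ℤ.- z)))))))

    decide : Dec (x ∼ y) → x ∼ y
    decide (yes x∼y) = x∼y
    decide (no  x≁y) = absurd x≁y (d≈± x y)

  -- Once `x` and `y` are equal, the coincidence says only that `z` and `t` are congruent modulo L,
  -- whatever the points are.
  ∼-shift : ∀ {x y x′ y′} z t → x ∼ y → x′ ∼ y′ → x + fromℤ z ∼ y + fromℤ t → x′ + fromℤ z ∼ y′ + fromℤ t
  ∼-shift {x} {y} {x′} {y′} z t x∼y x′∼y′ p =
    +-cong-[] L x′∼y′ (≈[]-trans L (≈⇒≈[] L (solve 2 (λ x z → z := (x :+ z) :- x) refl x (fromℤ z)))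
      (≈[]-trans L (+-cong-[] L p (-‿cong-[] L x∼y)) (≈⇒≈[] L (solve 2 (λ y t → (y :+ t) :- y := t) refl y (fromℤ t)))))

  Model : Set₁
  Model = Σ (Subset (𝕊 L)) λ S → Σ (Graph (points S)) (IsGECCircleGraph L S)

  structure : Model → Structure ℒGC
  structure (S , G , _) = structureGC L S G

  at : ∀ {P : R → Set} {n} → Vec (∃ P) n → Fin n → ℤ → R
  at ρ i z = proj₁ (lookup ρ i) + fromℤ z

  module _ {P P′ : R → Set} {n} (x : ∃ P) (x′ : ∃ P′) (ρ : Vec (∃ P) n) (ρ′ : Vec (∃ P′) n)
           (Z : List ℤ)
           (around : ∀ i j {a b} → a ∈ differences Z → b ∈ differences Z →
                     Circular L (proj₁ x) (at ρ i a) (at ρ j b) → Circular L (proj₁ x′) (at ρ′ i a) (at ρ′ j b))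
           where

    private
      X X′ : R
      X = proj₁ x
      X′ = proj₁ x′

      difference∈ : ∀ {a b} → a ∈ Z → b ∈ Z → (a ℤ.- b) ∈ differences Z
      difference∈ = ∈-cartesianProductWith⁺ ℤ._-_

    C-transfer₁ : ∀ {z t k} → z ∈ Z → t ∈ Z → k ∈ Z → ∀ i j →
                  Circular L (X + fromℤ z) (at ρ i t) (at ρ j k) → Circular L (X′ + fromℤ z) (at ρ′ i t) (at ρ′ j k)
    C-transfer₁ {z} {t} {k} z∈ t∈ k∈ i j h = from (recentre₁ z t k)
      (around i j (difference∈ t∈ z∈) (difference∈ k∈ z∈) (to (recentre₁ z t k) h))

    C-transfer₂ : ∀ {z t k} → z ∈ Z → t ∈ Z → k ∈ Z → ∀ i →
                  Circular L (X + fromℤ z) (X + fromℤ t) (at ρ i k) → Circular L (X′ + fromℤ z) (X′ + fromℤ t) (at ρ′ i k)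
    C-transfer₂ {z} {t} {k} z∈ t∈ k∈ i h = from (recentre₂ z t k)
      (around i i (difference∈ k∈ t∈) (difference∈ k∈ z∈) (to (recentre₂ z t k) h))

    C-transfer : ∀ {z t k} → z ∈ Z → t ∈ Z → k ∈ Z →
                 (∀ i j l → Circular L (at ρ i z) (at ρ j t) (at ρ l k) → Circular L (at ρ′ i z) (at ρ′ j t) (at ρ′ l k)) →
                 ∀ i j l → Circular L (at (x ∷ ρ) i z) (at (x ∷ ρ) j t) (at (x ∷ ρ) l k) →
                           Circular L (at (x′ ∷ ρ′) i z) (at (x′ ∷ ρ′) j t) (at (x′ ∷ ρ′) l k)
    -- Three shifts of one point are ordered independently of that point.
    C-transfer {z} {t} {k} z∈ t∈ k∈ old zero zero zero = translate-to (X′ - X) (move z) (move t) (move k)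
      where
      move : ∀ z → X + fromℤ z + (X′ - X) ≈ X′ + fromℤ z
      move z = solve 3 (λ x y z → x :+ z :+ (y :- x) := y :+ z) refl X X′ (fromℤ z)
    C-transfer z∈ t∈ k∈ old zero    (suc j) (suc l) = C-transfer₁ z∈ t∈ k∈ j l
    C-transfer z∈ t∈ k∈ old (suc i) zero    (suc l) = cyclic² ∘ C-transfer₁ t∈ k∈ z∈ l i ∘ C-cyclic L
    C-transfer z∈ t∈ k∈ old (suc i) (suc j) zero    = C-cyclic L ∘ C-transfer₁ k∈ z∈ t∈ i j ∘ cyclic²
    C-transfer z∈ t∈ k∈ old zero    zero    (suc l) = C-transfer₂ z∈ t∈ k∈ l
    C-transfer z∈ t∈ k∈ old (suc i) zero    zero    = cyclic² ∘ C-transfer₂ t∈ k∈ z∈ i ∘ C-cyclic L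
    C-transfer z∈ t∈ k∈ old zero    (suc j) zero    = C-cyclic L ∘ C-transfer₂ k∈ z∈ t∈ j ∘ cyclic²
    C-transfer z∈ t∈ k∈ old (suc i) (suc j) (suc l) = old i j l

  Agree-extend : ∀ {Σ} (m m′ : Model) {n} {ρ : Vec (Structure.Carrier (structure m)) n} {ρ′} →
                 Agree Σ (structure m) (structure m′) ρ ρ′ → ∀ {x x′} →
                 (∀ i → ¬ proj₁ x ∼ proj₁ (lookup ρ i)) → (∀ i → ¬ proj₁ x′ ∼ proj₁ (lookup ρ′ i)) →
                 (∀ i → Graph.Adj (proj₁ (proj₂ m)) x (lookup ρ i) ⇔ Graph.Adj (proj₁ (proj₂ m′)) x′ (lookup ρ′ i)) →
                 (∀ i j {a b} → a ∈ differences (shifts Σ) → b ∈ differences (shifts Σ) →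
                    Circular L (proj₁ x) (at ρ i a) (at ρ j b) ⇔ Circular L (proj₁ x′) (at ρ′ i a) (at ρ′ j b)) →
                 Agree Σ (structure m) (structure m′) (x ∷ ρ) (x′ ∷ ρ′)
  Agree-extend {Σ} (S , G , _) (S′ , G′ , _) {n} {ρ} {ρ′} e {x} {x′} fresh fresh′ adj around = record
    { ≐⇔ = equal ; rel⇔ = λ { {E} E∈ (i ∷ j ∷ []) → edge E∈ i j ; {C z t k} C∈ (i ∷ j ∷ l ∷ []) → circular C∈ i j l } }
    where
    module G = Graph G
    module G′ = Graph G′

    equal : ∀ i j → proj₁ (lookup (x ∷ ρ) i) ∼ proj₁ (lookup (x ∷ ρ) j) ⇔
                    proj₁ (lookup (x′ ∷ ρ′) i) ∼ proj₁ (lookup (x′ ∷ ρ′) j)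
    equal zero    zero    = mk⇔ (λ _ → ∼-refl) (λ _ → ∼-refl)
    equal zero    (suc j) = mk⇔ (⊥-elim ∘ fresh j) (⊥-elim ∘ fresh′ j)
    equal (suc i) zero    = mk⇔ (⊥-elim ∘ fresh i ∘ ≈[]-sym L) (⊥-elim ∘ fresh′ i ∘ ≈[]-sym L)
    equal (suc i) (suc j) = e .≐⇔ i j

    edge : E ∈ Σ → ∀ i j → G.Adj (lookup (x ∷ ρ) i) (lookup (x ∷ ρ) j) ⇔ G′.Adj (lookup (x′ ∷ ρ′) i) (lookup (x′ ∷ ρ′) j)
    edge E∈ zero    zero    = mk⇔ (⊥-elim ∘ G.Adj-irrefl ∼-refl) (⊥-elim ∘ G′.Adj-irrefl ∼-refl)
    edge E∈ zero    (suc j) = adj j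
    edge E∈ (suc i) zero    = mk⇔ (G′.Adj-sym ∘ to (adj i) ∘ G.Adj-sym) (G.Adj-sym ∘ from (adj i) ∘ G′.Adj-sym)
    edge E∈ (suc i) (suc j) = e .rel⇔ E∈ (i ∷ j ∷ [])

    circular : ∀ {z t k} → C z t k ∈ Σ → ∀ i j l →
               Circular L (at (x ∷ ρ) i z) (at (x ∷ ρ) j t) (at (x ∷ ρ) l k) ⇔
               Circular L (at (x′ ∷ ρ′) i z) (at (x′ ∷ ρ′) j t) (at (x′ ∷ ρ′) l k)
    circular C∈ i j l = mk⇔
      (C-transfer x x′ ρ ρ′ (shifts Σ) (λ i j a∈ b∈ → to (around i j a∈ b∈)) z∈ t∈ k∈
        (λ i j l → to (e .rel⇔ C∈ (i ∷ j ∷ l ∷ []))) i j l)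
      (C-transfer x′ x ρ′ ρ (shifts Σ) (λ i j a∈ b∈ → from (around i j a∈ b∈)) z∈ t∈ k∈
        (λ i j l → from (e .rel⇔ C∈ (i ∷ j ∷ l ∷ []))) i j l)
      where
      z∈ = ∈-shifts C∈ (here ≡.refl)
      t∈ = ∈-shifts C∈ (there (here ≡.refl))
      k∈ = ∈-shifts C∈ (there (there (here ≡.refl)))

  module _ {S S′ : Subset (𝕊 L)} {G : Graph (points S)} {G′ : Graph (points S′)}
           (g : IsGECCircleGraph L S G) (g′ : IsGECCircleGraph L S′ G′)
           {n} (ρ : Vec (Point S) n) (ρ′ : Vec (Point S′) n) where
    private
      module G = Graph G
      module G′ = Graph G′
      module g = IsGECCircleGraph g
      module g′ = IsGECCircleGraph g′

    -- The extension property does not control adjacency to vertices outside the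
    -- unit ball of s′; unitThreshold does.
    prescribe : (∀ i j → proj₁ (lookup ρ i) ∼ proj₁ (lookup ρ j) ⇔ proj₁ (lookup ρ′ i) ∼ proj₁ (lookup ρ′ j)) →
                ∀ x s′ → (∀ i → Near L 1# (proj₁ x) (proj₁ (lookup ρ i)) → Near L 1# (proj₁ s′) (proj₁ (lookup ρ′ i))) →
                ∀ ε → 0# < ε → ∃ λ v → d L (proj₁ s′) (proj₁ v) < ε ×
                  ((∀ i → Near L 1# (proj₁ v) (proj₁ (lookup ρ′ i)) → Near L 1# (proj₁ s′) (proj₁ (lookup ρ′ i))) →
                   ∀ i → G.Adj x (lookup ρ i) ⇔ G′.Adj v (lookup ρ′ i))
    prescribe ≐⇔ x s′ near-x ε 0<ε =
      let v , _ , _ , s′v<ε , vA , vB = IsGEC.extension g′.gec s′ (select Wanted) (select Unwanted)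
            (λ {v} → disjoint {v})
            -- Neighbours of `x` lie in its unit ball by the threshold of `G`, hence their
            -- counterparts lie in that of `s′`.
            (All.map (λ { (i , ≡.refl , xi) → from d<1⇔Near (near-x i (to d<1⇔Near (IsGEC.unitThreshold g.gec _ _ xi))) })
              (select-All Wanted))
            (All.map (λ { (i , ≡.refl , _ , s′i<1) → s′i<1 }) (select-All Unwanted)) ε 0<ε
      in v , s′v<ε , λ near-v i → mk⇔
        (λ xi → All.lookup vA (∈-select Wanted xi))
        (λ vi → unwanted vB near-v i vi em)
      where
      select : (Fin n → Set) → List (Point S′)
      select P = map (lookup ρ′) (filter (λ i → em {P i}) (allFin n))

      select-All : ∀ P → All (λ a → ∃ λ i → a ≡ lookup ρ′ i × P i) (select P)
      select-All P = All.map⁺ (All.map (λ Pi → _ , ≡.refl , Pi) (All.all-filter (λ i → em {P i}) (allFin n)))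

      ∈-select : ∀ P {i} → P i → lookup ρ′ i ∈ select P
      ∈-select P {i} Pi = ∈-map⁺ (lookup ρ′) (∈-filter⁺ (λ i → em {P i}) (∈-allFin i) Pi)

      Wanted Unwanted : Fin n → Set
      Wanted i   = G.Adj x (lookup ρ i)
      Unwanted i = ¬ G.Adj x (lookup ρ i) × d L (proj₁ s′) (proj₁ (lookup ρ′ i)) < 1#

      -- Different indices may name the same vertex. If entries `i` and `j` of `ρ′` coincide, so do
      -- those of `ρ`, and `x` cannot be adjacent to only one of them.
      disjoint : ∀ {v} → ¬ (Any (λ a → proj₁ v ∼ proj₁ a) (select Wanted) ×
                            Any (λ a → proj₁ v ∼ proj₁ a) (select Unwanted))
      disjoint (v∈A , v∈B) with All.lookupAny (select-All Wanted) v∈A | All.lookupAny (select-All Unwanted) v∈B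
      ... | (i , a≡ , xi) , v∼a | (j , b≡ , ¬xj , _) , v∼b =
        ¬xj (proj₁ G.Adj-resp (from (≐⇔ i j) (≈[]-trans L (≈[]-sym L (subst (λ a → _ ∼ proj₁ a) a≡ v∼a)) (subst (λ b → _ ∼ proj₁ b) b≡ v∼b))) xi)

      unwanted : ∀ {v} → All (λ b → ¬ G′.Adj v b) (select Unwanted) →
                 (∀ i → Near L 1# (proj₁ v) (proj₁ (lookup ρ′ i)) → Near L 1# (proj₁ s′) (proj₁ (lookup ρ′ i))) →
                 ∀ i → G′.Adj v (lookup ρ′ i) → Dec (G.Adj x (lookup ρ i)) → G.Adj x (lookup ρ i)
      unwanted vB near-v i vi (yes xi) = xi
      unwanted vB near-v i vi (no ¬xi) = ⊥-elim (All.lookup vB (∈-select Unwanted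
        (¬xi , from d<1⇔Near (near-v i (to d<1⇔Near (IsGEC.unitThreshold g′.gec _ _ vi))))) vi)

  extend-fresh : ∀ Σ (m m′ : Model) {n} (ρ : Vec (Structure.Carrier (structure m)) n) ρ′ →
                 Agree (refine Σ) (structure m) (structure m′) ρ ρ′ → ∀ x →
                 (∀ i → ¬ proj₁ x ∼ proj₁ (lookup ρ i)) →
                 ∃ λ x′ → Agree Σ (structure m) (structure m′) (x ∷ ρ) (x′ ∷ ρ′)
  -- Without old vertices there are no arcs and any vertex will do; density supplies one.
  extend-fresh Σ m m′@(_ , _ , g′) [] [] e x fresh =
    proj₁ (IsGECCircleGraph.dense g′ 0# 1# 0<1) ,
    Agree-extend m m′ (Agree-⊆ ∈-++⁺ˡ e) fresh (λ ()) (λ ()) (λ ())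
  extend-fresh Σ m@(S , G , g) m′@(S′ , G′ , g′) {ℕ.suc n} ρ@(_ ∷ _) ρ′@(_ ∷ _) e x fresh =
    -- The shifts of the first old vertex by 1 and -1 are the distinct points that start the search
    -- for an arc, even if there is only one old vertex.
    place (samePosition pt pt′ js C⇔ ∼⇔ freshAll (∈js zero (here ≡.refl)) (∈js zero (there (there (here ≡.refl)))) distinct)
    where
    W : List ℤ
    W = window (shifts Σ)

    js : List (Fin (ℕ.suc n) × ℤ)
    js = cartesianProduct (allFin (ℕ.suc n)) W

    ∈js : ∀ i {z} → z ∈ W → (i , z) ∈ js
    ∈js i z∈ = ∈-cartesianProduct⁺ (∈-allFin i) z∈

    shift∈ : ∀ {i z} → (i , z) ∈ js → z ∈ W
    shift∈ p = proj₂ (∈-cartesianProduct⁻ (allFin (ℕ.suc n)) W p)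

    pt pt′ : Fin (ℕ.suc n) × ℤ → R
    pt  (i , z) = at ρ i z
    pt′ (i , z) = at ρ′ i z

    C⇔ : ∀ {r s t} → r ∈ js → s ∈ js → t ∈ js →
         Circular L (pt r) (pt s) (pt t) ⇔ Circular L (pt′ r) (pt′ s) (pt′ t)
    C⇔ {i , _} {j , _} {l , _} r∈ s∈ t∈ =
      e .rel⇔ (∈-++⁺ʳ Σ (∈-circulars (shift∈ r∈) (shift∈ s∈) (shift∈ t∈))) (i ∷ j ∷ l ∷ [])

    ∼⇔ : ∀ {r s} → r ∈ js → s ∈ js → pt r ∼ pt s ⇔ pt′ r ∼ pt′ s
    ∼⇔ {i , z} {j , t} _ _ = mk⇔
      (λ p → let q = free⇒∼ S (IsGECCircleGraph.integerDistanceFree g) (lookup ρ i) (lookup ρ j) z t p in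
             ∼-shift z t q (to (e .≐⇔ i j) q) p)
      (λ p → let q = free⇒∼ S′ (IsGECCircleGraph.integerDistanceFree g′) (lookup ρ′ i) (lookup ρ′ j) z t p in
             ∼-shift z t q (from (e .≐⇔ i j) q) p)

    freshAll : ∀ {r} → r ∈ js → ¬ proj₁ x ∼ pt r
    freshAll {i , z} _ p = fresh i (free⇒∼ S (IsGECCircleGraph.integerDistanceFree g) x (lookup ρ i) (+ 0) z
      (≈[]-trans L (≈⇒≈[] L (+-identityʳ _)) p))

    distinct : ¬ pt (zero , + 1) ∼ pt (zero , -[1+ 0 ])
    distinct = irrefl₂₃ (to Near⇔C (Near-refl _))

    Goal : Set
    Goal = ∃ λ x′ → Agree Σ (structure m) (structure m′) (x ∷ ρ) (x′ ∷ ρ′)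

    Same : R → Set
    Same = SamePosition pt pt′ js C⇔ ∼⇔ (proj₁ x)

    near⇔ : ∀ {y} → Same y → ∀ i →
            Near L 1# (proj₁ x) (proj₁ (lookup ρ i)) ⇔ Near L 1# y (proj₁ (lookup ρ′ i))
    near⇔ (_ , same) i =
      ⇔-trans Near⇔C (⇔-trans (same (∈js i (here ≡.refl)) (∈js i (there (there (here ≡.refl))))) (⇔-sym Near⇔C))

    place : (∃₂ λ u v → ¬ u ∼ v × (∀ x′ → Circular L u x′ v → Same x′)) → Goal
    place (u , v , u≁v , same) = centre (C-between u≁v)
      where
      approach : ∀ s → Circular L u (proj₁ s) v →
                 (∃ λ ε → 0# < ε × (∀ y → Near L ε (proj₁ s) y → Circular L u y v)) → Goal
      approach s usv (ε , 0<ε , ball) =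
        finish (prescribe g g′ ρ ρ′ (e .≐⇔) x s (λ i → to (near⇔ same-s i)) ε 0<ε)
        where
        same-s : Same (proj₁ s)
        same-s = same (proj₁ s) usv

        finish : (∃ λ x′ → d L (proj₁ s) (proj₁ x′) < ε ×
                    ((∀ i → Near L 1# (proj₁ x′) (proj₁ (lookup ρ′ i)) → Near L 1# (proj₁ s) (proj₁ (lookup ρ′ i))) →
                     ∀ i → Graph.Adj G x (lookup ρ i) ⇔ Graph.Adj G′ x′ (lookup ρ′ i))) → Goal
        finish (x′ , sx′<ε , adj) = x′ , Agree-extend m m′ (Agree-⊆ ∈-++⁺ˡ e) fresh
          -- The shift 0 belongs to `window` for this: it makes `x′` differ from the old vertices
          -- themselves.
          (λ i x′∼ → proj₁ same-x′ (∈js i (there (here ≡.refl)))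
            (≈[]-trans L x′∼ (≈⇒≈[] L (sym (+-identityʳ _)))))
          -- Lying in the same arc, `s` and `x′` belong to the same unit balls around old vertices.
          (adj (λ i → to (near⇔ same-s i) ∘ from (near⇔ same-x′ i)))
          (λ i j a∈ b∈ → proj₂ same-x′ (∈js i (there (there (there a∈)))) (∈js j (there (there (there b∈)))))
          where
          same-x′ : Same (proj₁ x′)
          same-x′ = same (proj₁ x′) (ball (proj₁ x′) (d<⇒Near 0<ε sx′<ε))

      centre : (∃ λ w → Circular L u w v) → Goal
      centre (w , uwv) = dense (C-open uwv)
        where
        dense : (∃ λ η → 0# < η × (∀ y → Near L η w y → Circular L u y v)) → Goal
        dense (η , 0<η , ball) = near-centre (IsGECCircleGraph.dense g′ w η 0<η)
          where
          near-centre : (∃ λ (s : Point S′) → d L w (proj₁ s) < η) → Goal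
          near-centre (s , ws<η) = approach s usv (C-open usv)
            where
            usv : Circular L u (proj₁ s) v
            usv = ball (proj₁ s) (d<⇒Near 0<η ws<η)

  extend : ∀ Σ (m m′ : Model) {n} (ρ : Vec (Structure.Carrier (structure m)) n) ρ′ →
           Agree (refine Σ) (structure m) (structure m′) ρ ρ′ → ∀ x →
           ∃ λ x′ → Agree Σ (structure m) (structure m′) (x ∷ ρ) (x′ ∷ ρ′)
  extend Σ m m′ ρ ρ′ e x = cases em
    where
    cases : Dec (∃ λ i → proj₁ x ∼ proj₁ (lookup ρ i)) →
            ∃ λ x′ → Agree Σ (structure m) (structure m′) (x ∷ ρ) (x′ ∷ ρ′)
    cases (yes (i , x∼ρi)) = lookup ρ′ i , Agree-duplicate i (Agree-⊆ ∈-++⁺ˡ e) x∼ρi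
    cases (no fresh)       = extend-fresh Σ m m′ ρ ρ′ e x (λ i x∼ρi → fresh (i , x∼ρi))

  -- All arities are positive, so there are no atomic formulas without variables.
  start : ∀ Σ (m m′ : Model) → Agree Σ (structure m) (structure m′) [] []
  start Σ m m′ = record { ≐⇔ = λ () ; rel⇔ = λ { {E} _ (() ∷ _) ; {C _ _ _} _ (() ∷ _) } }

  open BackAndForth structure start refine extend public

theorem2p6 : (em : ExcludedMiddle 0ℓ) (ℝ : RealField) →
    let open Circles em ℝ in
    (L : Length)
    (S S′ : Subset (𝕊 L)) →
    IsDense ℝ (d L) S → IsDense ℝ (d L) S′ →
    IntegerDistanceFree L S → IntegerDistanceFree L S′ →
    (G : Graph (points S)) (G′ : Graph (points S′)) →
    IsGEC ℝ (d L) S G → IsGEC ℝ (d L) S′ G′ →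
    ElementarilyEquivalent (structureG G) (structureG G′) ×
    ElementarilyEquivalent (structureGC L S G) (structureGC L S′ G′) ×
    IsComplete (commonTheory L) ×
    HasQuantifierElimination (commonTheory L)
theorem2p6 em ℝ L S S′ dense dense′ free free′ G G′ gec gec′ =
  (λ σ → ⇔-trans (⇔-sym (embed-⊨ em ℝ L S G σ))
    (⇔-trans (elementarilyEquivalent m m′ (embed σ)) (embed-⊨ em ℝ L S′ G′ σ))) ,
  elementarilyEquivalent m m′ ,
  isComplete em m true⇒ true⇐ ,
  hasQuantifierElimination em m true⇒ true⇐
  where
  open Circles em ℝ
  open Extension em ℝ L

  m m′ : Model
  m  = S , G , record { dense = dense ; integerDistanceFree = free ; gec = gec }
  m′ = S′ , G′ , record { dense = dense′ ; integerDistanceFree = free′ ; gec = gec′ }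

  true⇒ : ∀ σ → commonTheory L σ → ∀ n → structure n ⊨ σ [ [] ]
  true⇒ σ h (S , G , g) = h S G g

  true⇐ : ∀ σ → (∀ n → structure n ⊨ σ [ [] ]) → commonTheory L σ
  true⇐ σ h S G g = h (S , G , g)
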